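{- Let $\mathbb{K}$ be an associative ring with unity (not necessarily commutative). Let $p,q$ be positive integers and let $P=[p]\times[q]$ be the $p\times q$-rectangle. Fix $\ell\in\mathbb{N}$, and let $f\in\mathbb{K}^{\widehat{P}}$ be a $\mathbb{K}$-labeling of $P$ such that $R^{\ell}f\neq\bot$, where $R$ is birational rowmotion of $P$. Set $a=f(0)$ and $b=f(1)$. Let $(i,j)\in P$ satisfy $\ell-i-j+1\geq 0$. Then $$\left(R^{\ell}f\right)(i,j)=a\cdot\Big(\left(R^{\ell-i-j+1}f\right)(p+1-i,\;q+1-j)\Big)^{ -1}\cdot b.$$
   Context: $\mathbb{K}$ is a fixed associative ring with unity, not necessarily commutative. An element is invertible if it has a two-sided inverse $x^{ -1}$. An equality in which an inverse $x^{ -1}$ appears is understood to include the assertion that $x$ is invertible (unless this is assumed). $\mathbb{N}=\{0,1,2,\ldots\}$. Extended poset. For a finite poset $P$, $\widehat{P}$ is the poset on the disjoint union $P\sqcup\{0,1\}$ in which $u\le v$ iff ($u,v\in P$ and $u\le v$ in $P$) or $u=0$ or $v=1$. Write $u\lessdot v$ (equivalently $v\gtrdot u$) if $u<v$ and no $w$ satisfies $u<w<v$ (in $\widehat{P}$). Labelings and partial maps. A $\mathbb{K}$-labeling of $P$ is a map $f:\widehat{P}\to\mathbb{K}$; the set of these is $\mathbb{K}^{\widehat{P}}$. For $(i,j)\in P$ write $f(i,j)$ for $f((i,j))$. A partial map $F:X\dashrightarrow Y$ is a map $X\to Y\sqcup\{\bot\}$, where $\bot$ means "undefined"; it is extended by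 $F(\bot)=\bot$, and partial maps are composed accordingly. Toggles. For $v\in P$, the toggle $T_v:\mathbb{K}^{\widehat{P}}\dashrightarrow\mathbb{K}^{\widehat{P}}$ is defined by $(T_vf)(w)=f(w)$ for $w\ne v$ and $$(T_vf)(v)=\Big(\sum_{u\in\widehat{P},\,u\lessdot v}f(u)\Big)\cdot f(v)^{ -1}\cdot\Big(\sum_{u\in\widehat{P},\,u\gtrdot v}f(u)^{ -1}\Big)^{ -1};$$ if any inverse in this formula does not exist, then $T_vf:=\bot$. Birational rowmotion. $R:=T_{v_1}\circ T_{v_2}\circ\cdots\circ T_{v_m}:\mathbb{K}^{\widehat{P}}\dashrightarrow\mathbb{K}^{\widehat{P}}$, where $(v_1,\ldots,v_m)$ is any linear extension of $P$ (a list of all elements of $P$, each exactly once, such that $v_i<v_j$ implies $i<j$); so the toggles at larger elements are applied first. This partial map does not depend on the choice of linear extension. $R^k$ is the $k$-fold composition, $R^0=\mathrm{id}$. Rectangle. For positive integers $p,q$, the $p\times q$-rectangle is $[p]\times[q]$ with $[n]=\{1,\ldots,n\}$ and order $(i,j)\le(i',j')$ iff $i\le i'$ and $j\le j'$. -}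

module Defs where

open import Level using (Level; _⊔_)
open import Algebra.Bundles using (Ring)
open import Algebra.Definitions using (Invertible)
open import Data.Fin as Fin using (Fin; toℕ; opposite)
import Data.Fin.Properties as Finₚ
open import Data.List using (List; []; _∷_; map; filter; foldr; lookup; allFin; cartesianProduct)
open import Data.List.Membership.Propositional using (_∈_; lose; find)
open import Data.List.Membership.Propositional.Properties using (∈-map⁺; ∈-allFin; ∈-cartesianProduct⁺)
open import Data.List.Relation.Unary.Any using (here; there; any?)
open import Data.List.Relation.Unary.Unique.Propositional using (Unique)
open import Data.List.Relation.Unary.Unique.Propositional.Properties using (allFin⁺; cartesianProduct⁺)
open import Data.Nat as ℕ using (ℕ; zero; suc; _∸_)
open import Data.Nat.Properties using (+-comm; +-∸-assoc)
open import Data.Product using (Σ-syntax; ∃-syntax; _×_; _,_; proj₁)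
open import Data.Product.Properties using (≡-dec)
open import Data.Unit.Polymorphic using (⊤; tt)
open import Relation.Binary.PropositionalEquality using (_≡_; refl; sym; cong₂; isEquivalence)
open import Relation.Binary.Structures using (IsDecPartialOrder)
open import Relation.Nullary using (¬_; Dec; yes; no; ¬?; _×-dec_)
open import Relation.Nullary.Decidable using (map′)
open import Relation.Nullary.Construct.Add.Extrema using (_±; ⊥±; ⊤±; [_])
import Relation.Binary.Construct.Add.Extrema.NonStrict as Extrema
import Relation.Binary.Construct.NonStrictToStrict as ToStrict

private variable
  a b c r s : Level

-- An element of X ⊔ {⊥}, where being different from ⊥ need not be decidable:
-- `Defined x` says that x ≠ ⊥, and evidence for it yields the actual element.
-- In this file evidence consists of the inverses occurring in a formula; these
-- are unique up to the equality of the ring, hence so is `value`.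
record Partial (X : Set a) (s : Level) : Set (a ⊔ Level.suc s) where
  field
    Defined : Set s
    value   : Defined → X

open Partial public

return : {X : Set a} → X → Partial X s
return x .Defined = ⊤
return x .value _ = x

infixl 1 _>>=_
_>>=_ : {X : Set a} {Y : Set b} → Partial X s → (X → Partial Y s) → Partial Y s
(x >>= F) .Defined       = Σ[ d ∈ Defined x ] Defined (F (value x d))
(x >>= F) .value (d , e) = value (F (value x d)) e

infixr 9 _∘ₚ_
_∘ₚ_ : {X : Set a} {Y : Set b} {Z : Set c} →
       (Y → Partial Z s) → (X → Partial Y s) → (X → Partial Z s)
(G ∘ₚ F) x = F x >>= G

infixr 10 _^ₚ_
_^ₚ_ : {X : Set a} → (X → Partial X s) → ℕ → (X → Partial X s)
F ^ₚ zero  = return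
F ^ₚ suc n = F ∘ₚ F ^ₚ n

record FinitePoset : Set₁ where
  field
    Carrier           : Set
    _≤_               : Carrier → Carrier → Set
    isDecPartialOrder : IsDecPartialOrder _≡_ _≤_
    elements          : List Carrier
    elements-unique   : Unique elements
    elements-complete : ∀ v → v ∈ elements

  open ToStrict _≡_ _≤_ public using (_<_)

-- The stdlib's `⊥±` and `⊤±` are the added elements 0 and 1; this `⊥±` has
-- nothing to do with being undefined.
module Extended (P : FinitePoset) where
  open FinitePoset P using (Carrier; _≤_; isDecPartialOrder; elements; elements-complete)

  P̂ : Set
  P̂ = Carrier ±

  open Extrema _≤_ public using (_≤±_)
  open ToStrict _≡_ _≤±_ public using () renaming (_<_ to _<±_)

  private module D = IsDecPartialOrder (Extrema.≤±-isDecPartialOrder-≡ _≤_ isDecPartialOrder)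

  _≟±_ : (u v : P̂) → Dec (u ≡ v)
  _≟±_ = D._≟_

  _<±?_ : (u v : P̂) → Dec (u <± v)
  _<±?_ = ToStrict.<-decidable _≡_ _≤±_ D._≟_ D._≤?_

  elements± : List P̂
  elements± = ⊥± ∷ ⊤± ∷ map [_] elements

  elements±-complete : ∀ v → v ∈ elements±
  elements±-complete ⊥±    = here refl
  elements±-complete ⊤±    = there (here refl)
  elements±-complete [ v ] = there (there (∈-map⁺ [_] (elements-complete v)))

  infix 4 _⋖_
  _⋖_ : P̂ → P̂ → Set
  u ⋖ v = u <± v × ¬ (∃[ w ] u <± w × w <± v)

  _⋖?_ : (u v : P̂) → Dec (u ⋖ v)
  u ⋖? v = (u <±? v) ×-dec ¬? between?
    where
    between? : Dec (∃[ w ] u <± w × w <± v)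
    between? = map′ (λ m → let w , _ , h = find m in w , h)
                    (λ (w , h) → lose (elements±-complete w) h)
                    (any? (λ w → (u <±? w) ×-dec (w <±? v)) elements±)

  lowerCovers upperCovers : P̂ → List P̂
  lowerCovers v = filter (λ u → u ⋖? v) elements±
  upperCovers v = filter (λ u → v ⋖? u) elements±

record IsLinearExtension (P : FinitePoset) (vs : List (FinitePoset.Carrier P)) : Set where
  open FinitePoset P
  field
    unique   : Unique vs
    complete : ∀ v → v ∈ vs
    monotone : ∀ i j → lookup vs i < lookup vs j → i Fin.< j

module _ (K : Ring c r) where
  open Ring K using (Carrier; _≈_; _+_; _*_; 0#; 1#)

  inverse : Carrier → Partial Carrier (c ⊔ r)
  inverse x .Defined = Invertible _≈_ 1# _*_ x
  inverse x .value   = proj₁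

  sum : List Carrier → Carrier
  sum = foldr _+_ 0#

  sumOfInverses : List Carrier → Partial Carrier (c ⊔ r)
  sumOfInverses []       = return 0#
  sumOfInverses (x ∷ xs) = do
    x⁻¹ ← inverse x
    s   ← sumOfInverses xs
    return (x⁻¹ + s)

module _ (K : Ring c r) (P : FinitePoset) where
  open Ring K using (_*_)
  open Extended P

  Labeling : Set c
  Labeling = P̂ → Ring.Carrier K

  _[_≔_] : Labeling → P̂ → Ring.Carrier K → Labeling
  (f [ v ≔ x ]) w with w ≟± v
  ... | yes _ = x
  ... | no  _ = f w

  toggle : FinitePoset.Carrier P → Labeling → Partial Labeling (c ⊔ r)
  toggle v f = do
    fv⁻¹ ← inverse K (f [ v ])
    s    ← sumOfInverses K (map f (upperCovers [ v ]))
    s⁻¹  ← inverse K s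
    return (f [ [ v ] ≔ sum K (map f (lowerCovers [ v ])) * fv⁻¹ * s⁻¹ ])

  -- Rowmotion computed along the list vs, which is meant to be a linear
  -- extension; the last toggle in the list acts first.
  rowmotion : List (FinitePoset.Carrier P) → Labeling → Partial Labeling (c ⊔ r)
  rowmotion = foldr (λ v F → toggle v ∘ₚ F) return

rectangle : ℕ → ℕ → FinitePoset
rectangle p q = record
  { Carrier           = Fin p × Fin q
  ; _≤_               = λ (i , j) (i′ , j′) → i Fin.≤ i′ × j Fin.≤ j′
  ; isDecPartialOrder = record
    { isPartialOrder = record
      { isPreorder = record
        { isEquivalence = isEquivalence
        ; reflexive     = λ { refl → Finₚ.≤-refl , Finₚ.≤-refl }
        ; trans         = λ (h , k) (h′ , k′) → Finₚ.≤-trans h h′ , Finₚ.≤-trans k k′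
        }
      ; antisym = λ (h , k) (h′ , k′) → cong₂ _,_ (Finₚ.≤-antisym h h′) (Finₚ.≤-antisym k k′)
      }
    ; _≟_  = ≡-dec Fin._≟_ Fin._≟_
    ; _≤?_ = λ (i , j) (i′ , j′) → (i Fin.≤? i′) ×-dec (j Fin.≤? j′)
    }
  ; elements          = cartesianProduct (allFin p) (allFin q)
  ; elements-unique   = cartesianProduct⁺ (allFin⁺ p) (allFin⁺ q)
  ; elements-complete = λ (i , j) → ∈-cartesianProduct⁺ (∈-allFin i) (∈-allFin j)
  }

-- `Fin n` stands for {1, …, n}; `index i` is the element of {1, …, n} that i
-- stands for, and `opposite` is then i ↦ n + 1 - i.
index : ∀ {n} → Fin n → ℕ
index i = suc (toℕ i)

index-opposite : ∀ {n} (i : Fin n) → index (opposite i) ≡ (n ℕ.+ 1) ∸ index i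
index-opposite {n} i rewrite Finₚ.opposite-prop i | +-comm n 1 = sym (+-∸-assoc 1 (Finₚ.toℕ<n i))

{-# OPTIONS --safe #-}

-- Fix 1-based coordinates and write F for a labeling, G = F⁻¹ and F′, G′ for the next step of rowmotion;
-- pad F by a at (1,0), G by b⁻¹ at (p,q+1), and both by 0 elsewhere.  With lower f v and upper g v the sums
-- over the lower and upper neighbours of v, the toggle relations say F′ v · upper G′ v = lower F v · G v.
--
-- Call ψ compatible with g if g v · lower ψ v = upper g v · ψ v on the rectangle; F is compatible with G′.
-- For ψ compatible with G let T (x,y) = Σ_{x′ ≤ x} G (x′,y+1) ψ (x′,y).  Compatibility telescopes to
-- T (x,y) = G (x+1,y+1) ψ (x,y+1) + T (x,y+1), hence T (p,0) = T (p,q), that is,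
-- Σ_x G (x,1) ψ (x,0) = b⁻¹ ψ (p,q).  Moreover Θ (x+1,y+1) = F (x+1,y+1) T (x,y), Θ (x+1,0) = ψ (x,0)
-- satisfies lower Θ v = lower F v · T and Θ v = F v · T with the same value of T, so it is compatible
-- with G′: the source has moved from (x,0) to (x+1,0), while Θ (x+1,q) = ψ (x,q).
-- Applying this n times to the labeling at time k gives reciprocity on the edge j = 1, and the toggle
-- relations then propagate it to j + 1 from j and j − 1.

module Submission where

open import Algebra.Bundles using (Ring)
open import Algebra.Definitions using (Invertible)
open import Data.Fin as Fin using (Fin; zero; suc; toℕ; fromℕ<; inject₁; opposite)
import Data.Fin.Properties as Finₚ
open import Data.List using (List; []; _∷_; map; filter; lookup)
open import Data.List.Membership.Propositional using (_∈_)
open import Data.List.Membership.Propositional.Properties using (∈-filter⁺; ∈-filter⁻)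
open import Data.List.Membership.Propositional.Properties.WithK using (unique∧set⇒bag)
open import Data.List.Properties using (map-cong-local)
open import Data.List.Relation.Binary.BagAndSetEquality using (∼bag⇒↭)
open import Data.List.Relation.Binary.Permutation.Propositional using (_↭_; ↭⇒↭ₛ′)
open import Data.List.Relation.Binary.Permutation.Propositional.Properties using (map⁺)
import Data.List.Relation.Binary.Permutation.Setoid.Properties as ↭ₛ
open import Data.List.Relation.Unary.All as All using (All; []; _∷_)
import Data.List.Relation.Unary.All.Properties as Allₚ
open import Data.List.Relation.Unary.AllPairs as AllPairs using (AllPairs; []; _∷_)
open import Data.List.Relation.Unary.Any as Any using (here; there)
import Data.List.Relation.Unary.Any.Properties as Anyₚ
open import Data.List.Relation.Unary.Unique.Propositional using (Unique)
import Data.List.Relation.Unary.Unique.Propositional.Properties as Uniqueₚ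
open import Data.Nat as ℕ using (ℕ; zero; suc; z≤n; s≤s; _≤_; _<_; _<?_; _≤?_; NonZero)
import Data.Nat.Properties as ℕₚ
open import Data.Product using (Σ-syntax; _×_; _,_; proj₁; proj₂)
open import Data.Sum using (_⊎_; inj₁; inj₂)
open import Function.Bundles using (mk⇔)
import Level
open import Relation.Binary.Construct.Add.Extrema.NonStrict using ([_]; ⊥±≤_; _≤⊤±; [≤]-injective)
import Relation.Binary.Construct.Add.Supremum.NonStrict as Sup
open import Relation.Binary.PropositionalEquality as ≡ using (_≡_; _≢_)
open import Relation.Nullary using (¬_; Dec; yes; no; contradiction; _×-dec_; _⊎-dec_)
open import Relation.Nullary.Construct.Add.Extrema using (⊥±; ⊤±; [_]; [_]-injective)
open import Defs

-- Compatible grids and their transport on the integer lattice.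

module Lattice {c r} (K : Ring c r) where
  open Ring K hiding (zero)
  open import Relation.Binary.Reasoning.Setoid setoid

  Grid : Set c
  Grid = ℕ → ℕ → Carrier

  upper lower : Grid → Grid
  upper g x y = g (suc x) y + g x (suc y)
  lower f (suc x) (suc y) = f x (suc y) + f (suc x) y
  lower f _       _       = 0#

  T : Grid → Grid → Grid
  T g ψ zero    y = 0#
  T g ψ (suc x) y = T g ψ x y + g (suc x) (suc y) * ψ (suc x) y

  Compatible : ℕ → ℕ → Grid → Grid → Set r
  Compatible p q g ψ = ∀ x y → x < p → y < q →
    g (suc x) (suc y) * lower ψ (suc x) (suc y) ≈ upper g (suc x) (suc y) * ψ (suc x) (suc y)

  module _ {p q : ℕ} {g ψ : Grid}
           (compatible : Compatible p q g ψ) (ψ0 : ∀ y → ψ 0 y ≈ 0#) where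

    -- Induction on `x`. The summand added to `T g ψ x y` completes `g₁₁ * lower ψ`, which
    -- compatibility trades for `upper g * ψ₁₁`. Of the two resulting terms, one extends the sum at
    -- `suc y` and the other is the new boundary term.
    T-step : ∀ x y → x ≤ p → y < q → T g ψ x y ≈ g (suc x) (suc y) * ψ x (suc y) + T g ψ x (suc y)
    T-step zero y _ _ = sym (begin
      g 1 (suc y) * ψ 0 (suc y) + 0#  ≈⟨ +-identityʳ _ ⟩
      g 1 (suc y) * ψ 0 (suc y)       ≈⟨ *-congˡ (ψ0 _) ⟩
      g 1 (suc y) * 0#                ≈⟨ zeroʳ _ ⟩
      0#                              ∎)
    T-step (suc x) y x<p y<q = begin
      T g ψ x y + g₁₁ * ψ (suc x) y                           ≈⟨ +-congʳ (T-step x y (ℕₚ.<⇒≤ x<p) y<q) ⟩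
      (g₁₁ * ψ x (suc y) + t) + g₁₁ * ψ (suc x) y             ≈⟨ +-congʳ (+-comm _ _) ⟩
      (t + g₁₁ * ψ x (suc y)) + g₁₁ * ψ (suc x) y             ≈⟨ +-assoc _ _ _ ⟩
      t + (g₁₁ * ψ x (suc y) + g₁₁ * ψ (suc x) y)             ≈⟨ +-congˡ (distribˡ _ _ _) ⟨
      t + g₁₁ * lower ψ (suc x) (suc y)                       ≈⟨ +-congˡ (compatible x y x<p y<q) ⟩
      t + upper g (suc x) (suc y) * ψ₁₁                       ≈⟨ +-congˡ (distribʳ _ _ _) ⟩
      t + (g (suc (suc x)) (suc y) * ψ₁₁ + g (suc x) (suc (suc y)) * ψ₁₁)  ≈⟨ +-congˡ (+-comm _ _) ⟩
      t + (g (suc x) (suc (suc y)) * ψ₁₁ + g (suc (suc x)) (suc y) * ψ₁₁)  ≈⟨ +-assoc _ _ _ ⟨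
      T g ψ (suc x) (suc y) + g (suc (suc x)) (suc y) * ψ₁₁   ≈⟨ +-comm _ _ ⟩
      g (suc (suc x)) (suc y) * ψ₁₁ + T g ψ (suc x) (suc y)   ∎
      where
      g₁₁ = g (suc x) (suc y)
      ψ₁₁ = ψ (suc x) (suc y)
      t = T g ψ x (suc y)

    -- At `x = p` the boundary term of `T-step` vanishes, so the full sum is independent of `y`.
    T-top-row : (∀ y → y < q → g (suc p) (suc y) ≈ 0#) → ∀ y → y ≤ q → T g ψ p 0 ≈ T g ψ p y
    T-top-row gₚ zero    _   = refl
    T-top-row gₚ (suc y) y<q = begin
      T g ψ p 0                                             ≈⟨ T-top-row gₚ y (ℕₚ.<⇒≤ y<q) ⟩
      T g ψ p y                                             ≈⟨ T-step p y ℕₚ.≤-refl y<q ⟩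
      g (suc p) (suc y) * ψ p (suc y) + T g ψ p (suc y)     ≈⟨ +-congʳ (*-congʳ (gₚ y y<q)) ⟩
      0# * ψ p (suc y) + T g ψ p (suc y)                    ≈⟨ +-congʳ (zeroˡ _) ⟩
      0# + T g ψ p (suc y)                                  ≈⟨ +-identityˡ _ ⟩
      T g ψ p (suc y)                                       ∎

  T-zero : ∀ {g ψ} y x → (∀ x′ → 0 < x′ → x′ ≤ x → g x′ (suc y) * ψ x′ y ≈ 0#) → T g ψ x y ≈ 0#
  T-zero y zero    h = refl
  T-zero y (suc x) h = trans (+-cong (T-zero y x (λ x′ l m → h x′ l (ℕₚ.m≤n⇒m≤1+n m)))
                                     (h (suc x) (s≤s z≤n) ℕₚ.≤-refl)) (+-identityʳ 0#)

  T-single : ∀ {g ψ} y n x → n < x → (∀ x′ → x′ ≢ suc n → g x′ (suc y) * ψ x′ y ≈ 0#) →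
             T g ψ x y ≈ g (suc n) (suc y) * ψ (suc n) y
  T-single y n (suc x) n<x h with n ℕ.≟ x
  ... | yes ≡.refl = trans (+-congʳ (T-zero y x (λ x′ _ l → h x′ (ℕₚ.<⇒≢ (s≤s l))))) (+-identityˡ _)
  ... | no  n≢x    = trans (+-cong (T-single y n x (ℕₚ.≤∧≢⇒< (ℕ.s≤s⁻¹ n<x) n≢x) h)
                                   (h (suc x) (λ e → n≢x (≡.sym (ℕₚ.suc-injective e))))) (+-identityʳ _)

  -- Conservation of flux. At `y = 0` the grid `ψ` is concentrated at the source `suc n`, and past
  -- the far side `g` is concentrated at `suc p`, so at each end the conserved sum reduces to one
  -- term.
  flow-through : ∀ {p q g ψ n} → Compatible (suc p) (suc q) g ψ → (∀ y → ψ 0 y ≈ 0#) →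
    (∀ y → y < suc q → g (suc (suc p)) (suc y) ≈ 0#) →
    (∀ x → x ≢ suc p → g x (suc (suc q)) ≈ 0#) →
    n < suc p → (∀ x → x ≢ suc n → ψ x 0 ≈ 0#) →
    g (suc n) 1 * ψ (suc n) 0 ≈ g (suc p) (suc (suc q)) * ψ (suc p) (suc q)
  flow-through {p} {q} {g} {ψ} {n} compatible ψ0 g-right g-top n<p ψ-bottom = begin
    g (suc n) 1 * ψ (suc n) 0  ≈⟨ T-single 0 n (suc p) n<p (λ x x≢ → trans (*-congˡ (ψ-bottom x x≢)) (zeroʳ _)) ⟨
    T g ψ (suc p) 0            ≈⟨ T-top-row compatible ψ0 g-right (suc q) ℕₚ.≤-refl ⟩
    T g ψ (suc p) (suc q)      ≈⟨ T-single (suc q) p (suc p) ℕₚ.≤-refl (λ x x≢ → trans (*-congʳ (g-top x x≢)) (zeroˡ _)) ⟩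
    g (suc p) (suc (suc q)) * ψ (suc p) (suc q)  ∎

  cancel-inverse : ∀ {x y} → x * y ≈ 1# → ∀ z → x * (y * z) ≈ z
  cancel-inverse xy≈1 z = trans (sym (*-assoc _ _ _)) (trans (*-congʳ xy≈1) (*-identityˡ z))

  Θ : Grid → Grid → Grid → Grid
  Θ f g ψ zero    y       = 0#
  Θ f g ψ (suc x) zero    = ψ x 0
  Θ f g ψ (suc x) (suc y) = f (suc x) (suc y) * T g ψ x y

  module _ {p q : ℕ} {f g ψ : Grid}
           (compatible : Compatible p q g ψ) (ψ0 : ∀ y → ψ 0 y ≈ 0#)
           (fg : ∀ x y → x < p → y < q → f (suc x) (suc y) * g (suc x) (suc y) ≈ 1#) where

    f*T : ∀ x y → x < p → y < q →
          f (suc x) (suc y) * T g ψ (suc x) y ≈ f (suc x) (suc y) * T g ψ x y + ψ (suc x) y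
    f*T x y x<p y<q = trans (distribˡ _ _ _) (+-congˡ (cancel-inverse (fg x y x<p y<q) _))

    -- The two lower neighbours carry different values of `T`. Both are moved to `t`: by `T-step`
    -- the second releases exactly the `ψ (suc x) (suc y)` that the first absorbs through `f*T`. At
    -- `y = 0` the boundary value `ψ (suc x) 0` is what gets absorbed.
    lower-Θ : (∀ x → f (suc (suc x)) 0 ≈ 0#) → ∀ x y → suc x < p → y < q →
              lower (Θ f g ψ) (suc (suc x)) (suc y) ≈ lower f (suc (suc x)) (suc y) * T g ψ (suc x) y
    lower-Θ f0 x zero x<p y<q = begin
      f (suc x) 1 * T g ψ x 0 + ψ (suc x) 0           ≈⟨ f*T x 0 (ℕₚ.<⇒≤ x<p) y<q ⟨
      f (suc x) 1 * T g ψ (suc x) 0                   ≈⟨ *-congʳ (+-identityʳ _) ⟨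
      (f (suc x) 1 + 0#) * T g ψ (suc x) 0            ≈⟨ *-congʳ (+-congˡ (f0 x)) ⟨
      (f (suc x) 1 + f (suc (suc x)) 0) * T g ψ (suc x) 0  ∎
    lower-Θ f0 x (suc y) x<p y<q = begin
      f₁ * T g ψ x (suc y) + f₂ * T g ψ (suc x) y
        ≈⟨ +-congˡ (*-congˡ (T-step compatible ψ0 (suc x) y (ℕₚ.<⇒≤ x<p) (ℕₚ.<⇒≤ y<q))) ⟩
      f₁ * T g ψ x (suc y) + f₂ * (g (suc (suc x)) (suc y) * ψ (suc x) (suc y) + t)
        ≈⟨ +-congˡ (trans (distribˡ _ _ _) (+-congʳ (cancel-inverse (fg (suc x) y x<p (ℕₚ.<⇒≤ y<q)) _))) ⟩
      f₁ * T g ψ x (suc y) + (ψ (suc x) (suc y) + f₂ * t)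
        ≈⟨ +-assoc _ _ _ ⟨
      (f₁ * T g ψ x (suc y) + ψ (suc x) (suc y)) + f₂ * t
        ≈⟨ +-congʳ (f*T x (suc y) (ℕₚ.<⇒≤ x<p) y<q) ⟨
      f₁ * t + f₂ * t
        ≈⟨ distribʳ _ _ _ ⟨
      (f₁ + f₂) * t ∎
      where
      f₁ = f (suc x) (suc (suc y))
      f₂ = f (suc (suc x)) (suc y)
      t = T g ψ (suc x) (suc y)

    -- At first coordinate 1 both sides vanish, since `Θ` is zero at first coordinates 0 and 1. The
    -- toggle relation enters from coordinate 2 on, which keeps clear of the corner (1,1), whose
    -- label may fail to be invertible at the final time.
    Θ-compatible : ∀ {g′} → (∀ x → f (suc (suc x)) 0 ≈ 0#) →
      (∀ x y → suc x < p → y < q →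
        g′ (suc (suc x)) (suc y) * lower f (suc (suc x)) (suc y)
          ≈ upper g′ (suc (suc x)) (suc y) * f (suc (suc x)) (suc y)) →
      Compatible p q g′ (Θ f g ψ)
    Θ-compatible {g′} f0 gf zero y x<p y<q = begin
      g′ 1 (suc y) * (0# + Θ f g ψ 1 y)  ≈⟨ *-congˡ (trans (+-identityˡ _) (Θ₁ y)) ⟩
      g′ 1 (suc y) * 0#                  ≈⟨ zeroʳ _ ⟩
      0#                                 ≈⟨ zeroʳ _ ⟨
      upper g′ 1 (suc y) * 0#            ≈⟨ *-congˡ (Θ₁ (suc y)) ⟨
      upper g′ 1 (suc y) * Θ f g ψ 1 (suc y)  ∎
      where
      Θ₁ : ∀ y → Θ f g ψ 1 y ≈ 0#
      Θ₁ zero    = ψ0 0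
      Θ₁ (suc y) = zeroʳ _
    Θ-compatible {g′} f0 gf (suc x) y x<p y<q = begin
      g′ (suc (suc x)) (suc y) * lower (Θ f g ψ) (suc (suc x)) (suc y)
        ≈⟨ *-congˡ (lower-Θ f0 x y x<p y<q) ⟩
      g′ (suc (suc x)) (suc y) * (lower f (suc (suc x)) (suc y) * T g ψ (suc x) y)
        ≈⟨ *-assoc _ _ _ ⟨
      g′ (suc (suc x)) (suc y) * lower f (suc (suc x)) (suc y) * T g ψ (suc x) y
        ≈⟨ *-congʳ (gf x y x<p y<q) ⟩
      upper g′ (suc (suc x)) (suc y) * f (suc (suc x)) (suc y) * T g ψ (suc x) y
        ≈⟨ *-assoc _ _ _ ⟩
      upper g′ (suc (suc x)) (suc y) * (f (suc (suc x)) (suc y) * T g ψ (suc x) y) ∎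

  -- For `x < suc p` the sum `T g ψ x (suc q)` meets only vanishing entries of `g`. Hence `T-step`
  -- leaves just its boundary term, and `f` cancels the factor `g` in it.
  Θ-right : ∀ {p q f g ψ} → Compatible (suc p) (suc q) g ψ → (∀ y → ψ 0 y ≈ 0#) →
    (∀ x y → x < suc p → y < suc q → f (suc x) (suc y) * g (suc x) (suc y) ≈ 1#) →
    (∀ x → x ≢ suc p → g x (suc (suc q)) ≈ 0#) →
    ∀ x → x < suc p → Θ f g ψ (suc x) (suc q) ≈ ψ x (suc q)
  Θ-right {p} {q} {f} {g} {ψ} compatible ψ0 fg g-top x x<p = begin
    f (suc x) (suc q) * T g ψ x q
      ≈⟨ *-congˡ (T-step compatible ψ0 x q (ℕₚ.<⇒≤ x<p) ℕₚ.≤-refl) ⟩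
    f (suc x) (suc q) * (g (suc x) (suc q) * ψ x (suc q) + T g ψ x (suc q))
      ≈⟨ *-congˡ (+-congˡ (T-zero (suc q) x (λ x′ _ l →
           trans (*-congʳ (g-top x′ (ℕₚ.<⇒≢ (ℕₚ.≤-<-trans l x<p)))) (zeroˡ _)))) ⟩
    f (suc x) (suc q) * (g (suc x) (suc q) * ψ x (suc q) + 0#)
      ≈⟨ *-congˡ (+-identityʳ _) ⟩
    f (suc x) (suc q) * (g (suc x) (suc q) * ψ x (suc q))
      ≈⟨ cancel-inverse (fg x q x<p ℕₚ.≤-refl) _ ⟩
    ψ x (suc q) ∎

-- Reciprocity for abstract padded grids: flows, the edge, and the induction on the second
-- coordinate.

module _ {c r} (K : Ring c r) where
  open Ring K hiding (zero)
  open Lattice K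
  open import Relation.Binary.Reasoning.Setoid setoid

  -- The rectangle has sides `suc p` and `suc q`; its points have 1-based coordinates `suc x` and
  -- `suc y`. The disjunction in `FG` and `GF` marks where inverses are available: everywhere before
  -- time `L`, and away from (1,1) at time `L`. `transition` is the toggle formula with the inverse
  -- of the upper sum cleared.
  module Dynamics (p q L : ℕ)
    (a b b⁻¹ : Carrier) (b⁻¹b : b⁻¹ * b ≈ 1#) (bb⁻¹ : b * b⁻¹ ≈ 1#)
    (F G : ℕ → Grid)
    (F-left : ∀ ℓ y → F ℓ 0 y ≈ 0#) (F-corner : ∀ ℓ → F ℓ 1 0 ≈ a) (F-bottom : ∀ ℓ x → F ℓ (suc (suc x)) 0 ≈ 0#)
    (G-right : ∀ ℓ y → y < suc q → G ℓ (suc (suc p)) (suc y) ≈ 0#)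
    (G-corner : ∀ ℓ → G ℓ (suc p) (suc (suc q)) ≈ b⁻¹)
    (G-top : ∀ ℓ x → x ≢ suc p → G ℓ x (suc (suc q)) ≈ 0#)
    (FG : ∀ ℓ x y → x < suc p → y < suc q → ℓ < L ⊎ (0 < x ℕ.+ y × ℓ ≤ L) →
      F ℓ (suc x) (suc y) * G ℓ (suc x) (suc y) ≈ 1#)
    (GF : ∀ ℓ x y → x < suc p → y < suc q → ℓ < L ⊎ (0 < x ℕ.+ y × ℓ ≤ L) →
      G ℓ (suc x) (suc y) * F ℓ (suc x) (suc y) ≈ 1#)
    (transition : ∀ ℓ x y → ℓ < L → x < suc p → y < suc q →
      F (suc ℓ) (suc x) (suc y) * upper (G (suc ℓ)) (suc x) (suc y) ≈ lower (F ℓ) (suc x) (suc y) * G ℓ (suc x) (suc y))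
    where
    -- The toggle relation multiplied by `g′` on the left and by `f` on the right; this is
    -- compatibility of `F ℓ` with `G (suc ℓ)` at one point.
    upper-F : ∀ ℓ x y → ℓ < L → x < suc p → y < suc q → suc ℓ < L ⊎ (0 < x ℕ.+ y × suc ℓ ≤ L) →
      G (suc ℓ) (suc x) (suc y) * lower (F ℓ) (suc x) (suc y)
        ≈ upper (G (suc ℓ)) (suc x) (suc y) * F ℓ (suc x) (suc y)
    upper-F ℓ x y ℓ<L x<p y<q known = sym (begin
      u * f                ≈⟨ cancel-inverse (GF (suc ℓ) x y x<p y<q known) _ ⟨
      g′ * (f′ * (u * f))  ≈⟨ *-congˡ (*-assoc _ _ _) ⟨
      g′ * (f′ * u * f)    ≈⟨ *-congˡ (*-congʳ (transition ℓ x y ℓ<L x<p y<q)) ⟩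
      g′ * (l * g * f)     ≈⟨ *-congˡ (*-assoc _ _ _) ⟩
      g′ * (l * (g * f))   ≈⟨ *-congˡ (*-congˡ (GF ℓ x y x<p y<q (inj₁ ℓ<L))) ⟩
      g′ * (l * 1#)        ≈⟨ *-congˡ (*-identityʳ _) ⟩
      g′ * l               ∎)
      where
      u = upper (G (suc ℓ)) (suc x) (suc y)
      f = F ℓ (suc x) (suc y)
      g = G ℓ (suc x) (suc y)
      l = lower (F ℓ) (suc x) (suc y)
      f′ = F (suc ℓ) (suc x) (suc y)
      g′ = G (suc ℓ) (suc x) (suc y)

    -- F (suc ℓ) 1 1 need not be invertible if suc ℓ = L; hence a is replaced by 1 here.
    corner-upper : ∀ ℓ → ℓ < L → upper (G (suc ℓ)) 1 1 * F ℓ 1 1 ≈ b⁻¹ * F ℓ (suc p) (suc q)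
    corner-upper ℓ ℓ<L = begin
      upper (G (suc ℓ)) 1 1 * F ℓ 1 1       ≈⟨ *-identityʳ _ ⟨
      g 1 1 * ψ 1 0                         ≈⟨ flow-through {g = g} {ψ} compatible (F-left ℓ) g-right g-top (s≤s z≤n) ψ-bottom ⟩
      g (suc p) (suc (suc q)) * ψ (suc p) (suc q)  ≈⟨ *-congʳ (trans (reflexive (g-above (suc p) q)) (G-corner (suc ℓ))) ⟩
      b⁻¹ * F ℓ (suc p) (suc q)             ∎
      where
      g ψ : Grid
      -- With source value 1, compatibility at (1,1) reads `g 1 1 ≈ upper g 1 1 * ψ 1 1`. The entry
      -- is chosen to satisfy this, so no inverse of `F (suc ℓ) 1 1` enters.
      g (suc zero) (suc zero) = upper (G (suc ℓ)) 1 1 * F ℓ 1 1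
      g x          y          = G (suc ℓ) x y
      ψ zero       y    = F ℓ zero y
      ψ (suc x) (suc y) = F ℓ (suc x) (suc y)
      ψ (suc zero) zero = 1#
      ψ (suc (suc x)) zero = F ℓ (suc (suc x)) zero
      g-right : ∀ y → y < suc q → g (suc (suc p)) (suc y) ≈ 0#
      g-right = G-right (suc ℓ)
      g-above : ∀ x y → g x (suc (suc y)) ≡ G (suc ℓ) x (suc (suc y))
      g-above zero          y = ≡.refl
      g-above (suc zero)    y = ≡.refl
      g-above (suc (suc x)) y = ≡.refl
      g-top : ∀ x → x ≢ suc p → g x (suc (suc q)) ≈ 0#
      g-top x x≢ = trans (reflexive (g-above x q)) (G-top (suc ℓ) x x≢)
      ψ-bottom : ∀ x → x ≢ 1 → ψ x 0 ≈ 0#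
      ψ-bottom zero          _   = F-left ℓ 0
      ψ-bottom (suc zero)    1≢1 = contradiction ≡.refl 1≢1
      ψ-bottom (suc (suc x)) _   = F-bottom ℓ x
      compatible : Compatible (suc p) (suc q) g ψ
      compatible zero zero _ _ = trans (*-congˡ (trans (+-congʳ (F-left ℓ 1)) (+-identityˡ 1#))) (*-identityʳ _)
      compatible zero (suc y) x<p y<q = upper-F ℓ 0 (suc y) ℓ<L x<p y<q (inj₂ (s≤s z≤n , ℓ<L))
      compatible (suc x) zero x<p y<q = upper-F ℓ (suc x) 0 ℓ<L x<p y<q (inj₂ (s≤s z≤n , ℓ<L))
      compatible (suc x) (suc y) x<p y<q = upper-F ℓ (suc x) (suc y) ℓ<L x<p y<q (inj₂ (s≤s z≤n , ℓ<L))

    -- The state after `n` applications of `Θ` to `F m`. Each application moves the time, the source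
    -- and the values at second coordinate `suc q` forward by one; `top` keeps those values that are
    -- still inside the rectangle.
    record Flow (m n : ℕ) : Set (c Level.⊔ r) where
      field
        ψ : Grid
        compatible : Compatible (suc p) (suc q) (G (n ℕ.+ suc m)) ψ
        left : ∀ y → ψ 0 y ≈ 0#
        source : ψ (suc n) 0 ≈ a
        bottom : ∀ x → x ≢ suc n → ψ x 0 ≈ 0#
        top : ∀ x → n ℕ.+ x ≤ suc p → ψ (n ℕ.+ x) (suc q) ≈ F m x (suc q)

    flow : ∀ m n → suc m < L → n ℕ.+ suc m ≤ L → Flow m n
    flow m zero m<L _ = record
      { ψ = F m
      ; compatible = λ x y x<p y<q → upper-F m x y (ℕₚ.<⇒≤ m<L) x<p y<q (inj₁ m<L)
      ; left = F-left m
      ; source = F-corner m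
      ; bottom = λ { zero _ → F-left m 0 ; (suc zero) 1≢1 → contradiction ≡.refl 1≢1
                   ; (suc (suc x)) _ → F-bottom m x }
      ; top = λ _ _ → refl
      }
    flow m (suc n) m<L n<L = record
      { ψ = Θ (F ℓ) (G ℓ) ψ
      ; compatible = Θ-compatible {f = F ℓ} {G ℓ} {ψ} compatible left FGℓ {G (suc ℓ)} (F-bottom ℓ)
          (λ x y x<p y<q → upper-F ℓ (suc x) y n<L x<p y<q (inj₂ (s≤s z≤n , n<L)))
      ; left = λ _ → refl
      ; source = source
      ; bottom = λ { zero _ → refl ; (suc x) x≢ → bottom x (λ e → x≢ (≡.cong suc e)) }
      ; top = λ x l → trans (Θ-right {f = F ℓ} {G ℓ} {ψ} compatible left FGℓ (G-top ℓ) (n ℕ.+ x) l) (top x (ℕₚ.<⇒≤ l))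
      }
      where
      ℓ = n ℕ.+ suc m
      open Flow (flow m n m<L (ℕₚ.<⇒≤ n<L))
      FGℓ : ∀ x y → x < suc p → y < suc q → F ℓ (suc x) (suc y) * G ℓ (suc x) (suc y) ≈ 1#
      FGℓ x y x<p y<q = FG ℓ x y x<p y<q (inj₁ n<L)

    -- The flux enters with value `a` at the source and leaves through a label of the starting time
    -- `m`, because transport only shifts the values at second coordinate `suc q`.
    flow-end : ∀ m n x → suc m < L → n ℕ.+ suc m ≤ L → n ℕ.+ x ≡ suc p → n < suc p →
               G (n ℕ.+ suc m) (suc n) 1 * a ≈ b⁻¹ * F m x (suc q)
    flow-end m n x m<L n<L e n<p = begin
      G ℓ (suc n) 1 * a               ≈⟨ *-congˡ source ⟨
      G ℓ (suc n) 1 * ψ (suc n) 0     ≈⟨ flow-through {g = G ℓ} {ψ} compatible left (G-right ℓ) (G-top ℓ) n<p bottom ⟩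
      G ℓ (suc p) (suc (suc q)) * ψ (suc p) (suc q)
                                      ≈⟨ *-cong (G-corner ℓ) (trans (reflexive (≡.cong (λ z → ψ z (suc q)) (≡.sym e)))
                                                                 (top x (ℕₚ.≤-reflexive e))) ⟩
      b⁻¹ * F m x (suc q)             ∎
      where
      ℓ = n ℕ.+ suc m
      open Flow (flow m n m<L n<L)

    -- Both directions of b · x⁻¹ · a = y ⇔ x = a · y⁻¹ · b hold without assuming a invertible.
    flip-inverse : ∀ {x x⁻¹ y y⁻¹} → x * x⁻¹ ≈ 1# → y * y⁻¹ ≈ 1# → x⁻¹ * a ≈ b⁻¹ * y → x ≈ a * y⁻¹ * b
    flip-inverse {x} {x⁻¹} {y} {y⁻¹} xx⁻¹ yy⁻¹ h = sym (begin
      a * y⁻¹ * b                ≈⟨ *-congʳ (*-congʳ (cancel-inverse xx⁻¹ a)) ⟨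
      x * (x⁻¹ * a) * y⁻¹ * b    ≈⟨ *-congʳ (*-congʳ (*-congˡ h)) ⟩
      x * (b⁻¹ * y) * y⁻¹ * b    ≈⟨ *-congʳ (*-assoc _ _ _) ⟩
      x * (b⁻¹ * y * y⁻¹) * b    ≈⟨ *-congʳ (*-congˡ (*-assoc _ _ _)) ⟩
      x * (b⁻¹ * (y * y⁻¹)) * b  ≈⟨ *-congʳ (*-congˡ (*-congˡ yy⁻¹)) ⟩
      x * (b⁻¹ * 1#) * b         ≈⟨ *-congʳ (*-congˡ (*-identityʳ _)) ⟩
      x * b⁻¹ * b                ≈⟨ *-assoc _ _ _ ⟩
      x * (b⁻¹ * b)              ≈⟨ *-congˡ b⁻¹b ⟩
      x * 1#                     ≈⟨ *-identityʳ _ ⟩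
      x                          ∎)

    unflip-inverse : ∀ {x x⁻¹ y y⁻¹} → x⁻¹ * x ≈ 1# → y⁻¹ * y ≈ 1# → x ≈ a * y⁻¹ * b → b * x⁻¹ * a ≈ y
    unflip-inverse {x} {x⁻¹} {y} {y⁻¹} x⁻¹x y⁻¹y h = begin
      b * x⁻¹ * a                         ≈⟨ *-identityʳ _ ⟨
      b * x⁻¹ * a * 1#                    ≈⟨ *-congˡ y⁻¹y ⟨
      b * x⁻¹ * a * (y⁻¹ * y)             ≈⟨ *-congˡ (*-congˡ (cancel-inverse bb⁻¹ y)) ⟨
      b * x⁻¹ * a * (y⁻¹ * (b * (b⁻¹ * y)))  ≈⟨ *-assoc _ _ _ ⟩
      b * x⁻¹ * (a * (y⁻¹ * (b * (b⁻¹ * y))))  ≈⟨ *-congˡ (trans (sym (*-assoc _ _ _)) (sym (*-assoc _ _ _))) ⟩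
      b * x⁻¹ * (a * y⁻¹ * b * (b⁻¹ * y))  ≈⟨ *-congˡ (*-congʳ h) ⟨
      b * x⁻¹ * (x * (b⁻¹ * y))           ≈⟨ *-assoc _ _ _ ⟩
      b * (x⁻¹ * (x * (b⁻¹ * y)))         ≈⟨ *-congˡ (cancel-inverse x⁻¹x _) ⟩
      b * (b⁻¹ * y)                       ≈⟨ cancel-inverse bb⁻¹ y ⟩
      y                                   ∎

    -- Subtraction-free form of the claim at `i = suc x`, `j = y`: the sums express the antipode
    -- (`suc x′`, `suc y′`) and the earlier time `k = ℓ - i - j + 1`. The value `y = 0` is allowed
    -- and refers to the padding.
    Reciprocal : ℕ → Set r
    Reciprocal y = ∀ ℓ x x′ y′ k → x ℕ.+ x′ ≡ p → y ℕ.+ y′ ≡ suc q → k ℕ.+ x ℕ.+ y ≡ ℓ → ℓ ≤ L →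
      F ℓ (suc x) y ≈ a * G k (suc x′) (suc y′) * b

    -- The paddings of `F` and `G` are antipodal: `a` faces `b⁻¹`, and zeros face zeros. This
    -- supplies the lower neighbour outside the rectangle when the induction passes from second
    -- coordinate 1 to 2.
    reciprocal₀ : Reciprocal 0
    reciprocal₀ ℓ zero x′ y′ k ≡.refl ≡.refl _ _ = begin
      F ℓ 1 0                              ≈⟨ F-corner ℓ ⟩
      a                                    ≈⟨ *-identityʳ a ⟨
      a * 1#                               ≈⟨ *-congˡ b⁻¹b ⟨
      a * (b⁻¹ * b)                        ≈⟨ *-assoc _ _ _ ⟨
      a * b⁻¹ * b                          ≈⟨ *-congʳ (*-congˡ (G-corner k)) ⟨
      a * G k (suc p) (suc (suc q)) * b    ∎
    reciprocal₀ ℓ (suc x) x′ y′ k ≡.refl ≡.refl _ _ = begin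
      F ℓ (suc (suc x)) 0                  ≈⟨ F-bottom ℓ x ⟩
      0#                                   ≈⟨ zeroˡ b ⟨
      0# * b                               ≈⟨ *-congʳ (zeroʳ a) ⟨
      a * 0# * b                           ≈⟨ *-congʳ (*-congˡ (G-top k (suc x′) (λ e → ℕₚ.m≢1+n+m x′ (ℕₚ.suc-injective e)))) ⟨
      a * G k (suc x′) (suc (suc q)) * b   ∎

    private
      summand< : ∀ {n m} m′ → m′ ℕ.+ m ≡ n → m < suc n
      summand< m′ ≡.refl = s≤s (ℕₚ.m≤n+m _ m′)

      summand<ˡ : ∀ {n m} m′ → m ℕ.+ m′ ≡ n → m < suc n
      summand<ˡ m′ ≡.refl = s≤s (ℕₚ.m≤m+n _ m′)

    -- `transition` gives `F (suc k) 1 1 * S ≈ a * G k 1 1`, and `corner-upper` exhibits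
    -- `F k 1 1 * (g * b)` as a right inverse of `S`. No inverse of the new corner label is used, so
    -- the final time is covered.
    reciprocal-corner : ∀ k → k < L → F (suc k) 1 1 ≈ a * G k (suc p) (suc q) * b
    reciprocal-corner k k<L = begin
      F (suc k) 1 1                                        ≈⟨ *-identityʳ _ ⟨
      F (suc k) 1 1 * 1#                                   ≈⟨ *-congˡ S⁻¹ ⟨
      F (suc k) 1 1 * (S * (F k 1 1 * (g * b)))            ≈⟨ *-assoc _ _ _ ⟨
      F (suc k) 1 1 * S * (F k 1 1 * (g * b))              ≈⟨ *-congʳ (transition k 0 0 k<L (s≤s z≤n) (s≤s z≤n)) ⟩
      (F k 0 1 + F k 1 0) * G k 1 1 * (F k 1 1 * (g * b))
        ≈⟨ *-congʳ (*-congʳ (trans (+-cong (F-left k 1) (F-corner k)) (+-identityˡ a))) ⟩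
      a * G k 1 1 * (F k 1 1 * (g * b))                    ≈⟨ *-assoc _ _ _ ⟩
      a * (G k 1 1 * (F k 1 1 * (g * b)))
        ≈⟨ *-congˡ (cancel-inverse (GF k 0 0 (s≤s z≤n) (s≤s z≤n) (inj₁ k<L)) _) ⟩
      a * (g * b)                                          ≈⟨ *-assoc _ _ _ ⟨
      a * g * b                                            ∎
      where
      S = upper (G (suc k)) 1 1
      g = G k (suc p) (suc q)
      S⁻¹ : S * (F k 1 1 * (g * b)) ≈ 1#
      S⁻¹ = begin
        S * (F k 1 1 * (g * b))              ≈⟨ *-assoc _ _ _ ⟨
        S * F k 1 1 * (g * b)                ≈⟨ *-congʳ (corner-upper k k<L) ⟩
        b⁻¹ * F k (suc p) (suc q) * (g * b)  ≈⟨ *-assoc _ _ _ ⟩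
        b⁻¹ * (F k (suc p) (suc q) * (g * b)) ≈⟨ *-congˡ (cancel-inverse (FG k p q ℕₚ.≤-refl ℕₚ.≤-refl (inj₁ k<L)) b) ⟩
        b⁻¹ * b                              ≈⟨ b⁻¹b ⟩
        1#                                   ∎

    -- A flow started at time `k` reaches this point after `suc n` transports. At least one
    -- transport takes place, whence `suc k < L`, as `flow` demands; the corner itself belongs to
    -- `reciprocal-corner`.
    reciprocal-edge : ∀ k n x → suc n ℕ.+ suc k ≤ L → suc n ℕ.+ x ≡ p →
                      F (suc n ℕ.+ suc k) (suc (suc n)) 1 ≈ a * G k (suc x) (suc q) * b
    reciprocal-edge k n x ℓ≤L e =
      flip-inverse (FG (suc n ℕ.+ suc k) (suc n) 0 n<p (s≤s z≤n) (inj₂ (s≤s z≤n , ℓ≤L)))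
                   (FG k x q x<p ℕₚ.≤-refl (inj₁ (ℕₚ.<⇒≤ k<L)))
                   (flow-end k (suc n) (suc x) k<L ℓ≤L (≡.trans (ℕₚ.+-suc (suc n) x) (≡.cong suc e)) n<p)
      where
      n<p = summand<ˡ x e
      x<p = summand< (suc n) e
      k<L : suc k < L
      k<L = ℕₚ.≤-trans (ℕₚ.+-monoˡ-≤ (suc k) (s≤s (z≤n {n}))) ℓ≤L

    reciprocal₁ : Reciprocal 1
    reciprocal₁ ℓ zero x′ y′ k ≡.refl ≡.refl e ℓ≤L =
      ≡.subst (λ ℓ → F ℓ 1 1 ≈ _) e′ (reciprocal-corner k (≡.subst (_≤ L) (≡.sym e′) ℓ≤L))
      where
      e′ : suc k ≡ ℓ
      e′ = ≡.trans (≡.trans (≡.cong suc (≡.sym (ℕₚ.+-identityʳ k))) (ℕₚ.+-comm 1 _)) e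
    reciprocal₁ ℓ (suc n) x′ y′ k p≡ ≡.refl e ℓ≤L =
      ≡.subst (λ ℓ → F ℓ (suc (suc n)) 1 ≈ _) e′ (reciprocal-edge k n x′ (≡.subst (_≤ L) (≡.sym e′) ℓ≤L) p≡)
      where
      e′ : suc n ℕ.+ suc k ≡ ℓ
      e′ = ≡.trans (≡.trans (ℕₚ.+-comm (suc n) (suc k)) (ℕₚ.+-comm 1 _)) e

    -- The toggle relation at `v = (suc x, suc y)` from time `ℓ` to `suc ℓ` is matched with the one
    -- at its antipode from time `k` to `suc k`; the breve marks quantities at the antipode. The
    -- result is reciprocity for the sum over the two upper neighbours of `v`. One of them is known
    -- by `rec₁`, and additive cancellation leaves the other, at `suc (suc y)`.
    module Step (y : ℕ) (rec₀ : Reciprocal y) (rec₁ : Reciprocal (suc y))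
                (k x x′ y′ : ℕ) (x+x′ : x ℕ.+ x′ ≡ p) (y+y′ : suc (suc y) ℕ.+ y′ ≡ suc q)
                (ℓ<L : k ℕ.+ x ℕ.+ suc y < L) where

      ℓ : ℕ
      ℓ = k ℕ.+ x ℕ.+ suc y

      x<p : x < suc p
      x<p = summand<ˡ x′ x+x′
      x′<p : x′ < suc p
      x′<p = summand< x x+x′
      y<q : suc y < suc q
      y<q = summand<ˡ y′ (ℕₚ.suc-injective y+y′)
      y+sy′ : suc y ℕ.+ suc y′ ≡ suc q
      y+sy′ = ≡.trans (ℕₚ.+-suc (suc y) y′) y+y′
      y′<q : suc y′ < suc q
      y′<q = summand< y (ℕₚ.suc-injective y+sy′)
      sk≤ℓ : suc k ≤ ℓ
      sk≤ℓ = ≡.subst (suc k ≤_) (≡.sym (ℕₚ.+-suc (k ℕ.+ x) y)) (s≤s (ℕₚ.≤-trans (ℕₚ.m≤m+n k x) (ℕₚ.m≤m+n (k ℕ.+ x) y)))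
      sk<L : suc k < L
      sk<L = ℕₚ.≤-<-trans sk≤ℓ ℓ<L
      k<L : k < L
      k<L = ℕₚ.<⇒≤ sk<L

      f = F ℓ (suc x) (suc y)
      g = G ℓ (suc x) (suc y)
      f˘ = F (suc k) (suc x′) (suc (suc y′))
      u = upper (G (suc ℓ)) (suc x) (suc y)
      u˘ = upper (G (suc k)) (suc x′) (suc (suc y′))

      -- Lower neighbours have coordinate sum smaller by one, so at time `ℓ` reciprocity pairs them
      -- with time `suc k` instead of `k`. For `x = 0` a padding zero faces a padding zero.
      lower-reciprocal : lower (F ℓ) (suc x) (suc y) ≈ a * u˘ * b
      lower-reciprocal = begin
        F ℓ x (suc y) + F ℓ (suc x) y      ≈⟨ +-cong (left x x+x′ ≡.refl)
          (rec₀ ℓ x x′ (suc (suc y′)) (suc k) x+x′ (≡.trans (ℕₚ.+-suc y (suc y′)) y+sy′)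
            (≡.sym (ℕₚ.+-suc (k ℕ.+ x) y)) (ℕₚ.<⇒≤ ℓ<L)) ⟩
        a * g₁ * b + a * g₂ * b            ≈⟨ distribʳ _ _ _ ⟨
        (a * g₁ + a * g₂) * b              ≈⟨ *-congʳ (distribˡ _ _ _) ⟨
        a * u˘ * b                         ∎
        where
        g₁ = G (suc k) (suc (suc x′)) (suc (suc y′))
        g₂ = G (suc k) (suc x′) (suc (suc (suc y′)))
        left : ∀ x → x ℕ.+ x′ ≡ p → k ℕ.+ x ℕ.+ suc y ≡ ℓ → F ℓ x (suc y) ≈ a * g₁ * b
        left zero ≡.refl _ = begin
          F ℓ 0 (suc y)  ≈⟨ F-left ℓ (suc y) ⟩
          0#             ≈⟨ zeroˡ b ⟨
          0# * b         ≈⟨ *-congʳ (zeroʳ a) ⟨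
          a * 0# * b     ≈⟨ *-congʳ (*-congˡ (G-right (suc k) (suc y′) y′<q)) ⟨
          a * g₁ * b     ∎
        left (suc x) e e′ = rec₁ ℓ x (suc x′) (suc y′) (suc k) (≡.trans (ℕₚ.+-suc x x′) e) y+sy′
          (≡.trans (≡.cong (ℕ._+ suc y) (≡.sym (ℕₚ.+-suc k x))) e′) (ℕₚ.<⇒≤ ℓ<L)

      right-reciprocal : b * G (suc ℓ) (suc (suc x)) (suc y) * a ≈ F k x′ (suc (suc y′))
      right-reciprocal = right x′ x+x′
        where
        right : ∀ x′ → x ℕ.+ x′ ≡ p → b * G (suc ℓ) (suc (suc x)) (suc y) * a ≈ F k x′ (suc (suc y′))
        right zero e with ≡.refl ← ≡.trans (≡.sym (ℕₚ.+-identityʳ x)) e = begin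
          b * G (suc ℓ) (suc (suc x)) (suc y) * a  ≈⟨ *-congʳ (*-congˡ (G-right (suc ℓ) y (ℕₚ.<⇒≤ y<q))) ⟩
          b * 0# * a                               ≈⟨ *-congʳ (zeroʳ b) ⟩
          0# * a                                   ≈⟨ zeroˡ a ⟩
          0#                                       ≈⟨ F-left k _ ⟨
          F k 0 (suc (suc y′))                     ∎
        right (suc x′) e = unflip-inverse
          (GF (suc ℓ) (suc x) y (summand<ˡ x′ e′) (ℕₚ.<⇒≤ y<q) (inj₂ (s≤s z≤n , ℓ<L)))
          (GF k x′ (suc y′) (summand< (suc x) e′) y′<q (inj₁ k<L))
          (rec₁ (suc ℓ) (suc x) x′ (suc y′) k e′ y+sy′ (≡.cong (ℕ._+ suc y) (ℕₚ.+-suc k x)) ℓ<L)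
          where
          e′ : suc x ℕ.+ x′ ≡ p
          e′ = ≡.trans (≡.sym (ℕₚ.+-suc x x′)) e

      -- Away from the corner, `upper-F` turns `u * f` into `g′` times a lower sum, and reciprocity
      -- applies to both factors. At (1,1) the inverse `g′` may be missing; there `corner-upper`
      -- replaces it, and the antipode is maximal, so `u˘` is `b⁻¹`.
      upper-f : b * u * f ≈ f˘ * u˘ * b
      upper-f = by-cases x y ≡.refl ≡.refl
        where
        generic : 0 < x ℕ.+ y → b * u * f ≈ f˘ * u˘ * b
        generic 0<x+y = begin
          b * u * f                                ≈⟨ *-assoc _ _ _ ⟩
          b * (u * f)                              ≈⟨ *-congˡ (upper-F ℓ x y ℓ<L x<p (ℕₚ.<⇒≤ y<q) (inj₂ (0<x+y , ℓ<L))) ⟨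
          b * (g′ * lower (F ℓ) (suc x) (suc y))   ≈⟨ *-congˡ (*-congˡ lower-reciprocal) ⟩
          b * (g′ * (a * u˘ * b))                  ≈⟨ *-assoc _ _ _ ⟨
          b * g′ * (a * u˘ * b)                    ≈⟨ *-assoc _ _ _ ⟨
          b * g′ * (a * u˘) * b                    ≈⟨ *-congʳ (*-assoc _ _ _) ⟨
          b * g′ * a * u˘ * b                      ≈⟨ *-congʳ (*-congʳ g′-reciprocal) ⟩
          f˘ * u˘ * b                              ∎
          where
          g′ = G (suc ℓ) (suc x) (suc y)
          g′-reciprocal : b * g′ * a ≈ f˘
          g′-reciprocal = unflip-inverse
            (GF (suc ℓ) x y x<p (ℕₚ.<⇒≤ y<q) (inj₂ (0<x+y , ℓ<L)))
            (GF (suc k) x′ (suc y′) x′<p y′<q (inj₁ sk<L))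
            (rec₁ (suc ℓ) x x′ (suc y′) (suc k) x+x′ y+sy′ ≡.refl ℓ<L)
        corner : x ≡ 0 → y ≡ 0 → b * u * f ≈ f˘ * u˘ * b
        corner ≡.refl ≡.refl = begin
          b * u * f                                 ≈⟨ *-assoc _ _ _ ⟩
          b * (u * f)                               ≈⟨ *-congˡ (corner-upper ℓ ℓ<L) ⟩
          b * (b⁻¹ * F ℓ (suc p) (suc q))           ≈⟨ cancel-inverse bb⁻¹ _ ⟩
          F ℓ (suc p) (suc q)                       ≈⟨ *-identityʳ _ ⟨
          F ℓ (suc p) (suc q) * 1#                  ≈⟨ *-cong (reflexive f≡) u˘b ⟨
          f˘ * (u˘ * b)                             ≈⟨ *-assoc _ _ _ ⟨
          f˘ * u˘ * b                               ∎
          where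
          ℓ≡ : suc k ≡ ℓ
          ℓ≡ = ≡.trans (≡.cong suc (≡.sym (ℕₚ.+-identityʳ k))) (ℕₚ.+-comm 1 _)
          f≡ : f˘ ≡ F ℓ (suc p) (suc q)
          f≡ = ≡.cong₂ (λ ℓ z → F ℓ (suc (proj₁ z)) (proj₂ z)) ℓ≡ (≡.cong₂ _,_ x+x′ y+y′)
          u˘b : u˘ * b ≈ 1#
          u˘b = begin
            u˘ * b           ≈⟨ *-congʳ (reflexive (≡.cong₂ (λ x y → upper (G (suc k)) (suc x) y) x+x′ y+y′)) ⟩
            (G (suc k) (suc (suc p)) (suc q) + G (suc k) (suc p) (suc (suc q))) * b
                             ≈⟨ *-congʳ (trans (+-cong (G-right (suc k) q ℕₚ.≤-refl) (G-corner (suc k))) (+-identityˡ b⁻¹)) ⟩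
            b⁻¹ * b          ≈⟨ b⁻¹b ⟩
            1#               ∎
        by-cases : ∀ x₀ y₀ → x ≡ x₀ → y ≡ y₀ → b * u * f ≈ f˘ * u˘ * b
        by-cases zero    zero    e e′ = corner e e′
        by-cases zero    (suc _) e e′ = generic (≡.subst (0 <_) (≡.sym (≡.cong₂ ℕ._+_ e e′)) (s≤s z≤n))
        by-cases (suc _) _       e e′ = generic (≡.subst (0 <_) (≡.sym (≡.cong₂ ℕ._+_ e e′)) (s≤s z≤n))

      -- Inserting `f * g` makes `upper-f` applicable; reciprocity at `v` rewrites `b * g * a`, and
      -- the toggle relation at the antipode turns `f˘ * u˘` into the lower sum.
      upper-reciprocal : b * u * a ≈ lower (F k) (suc x′) (suc (suc y′))
      upper-reciprocal = begin
        b * u * a                ≈⟨ *-congˡ (cancel-inverse (FG ℓ x y x<p (ℕₚ.<⇒≤ y<q) (inj₁ ℓ<L)) a) ⟨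
        b * u * (f * (g * a))    ≈⟨ *-assoc _ _ _ ⟨
        b * u * f * (g * a)      ≈⟨ *-congʳ upper-f ⟩
        f˘ * u˘ * b * (g * a)    ≈⟨ *-assoc _ _ _ ⟩
        f˘ * u˘ * (b * (g * a))  ≈⟨ *-congˡ (*-assoc _ _ _) ⟨
        f˘ * u˘ * (b * g * a)    ≈⟨ *-congˡ g-reciprocal ⟩
        f˘ * u˘ * F k (suc x′) (suc (suc y′))
                                 ≈⟨ *-congʳ (transition k x′ (suc y′) k<L x′<p y′<q) ⟩
        lower (F k) (suc x′) (suc (suc y′)) * G k (suc x′) (suc (suc y′)) * F k (suc x′) (suc (suc y′))
                                 ≈⟨ *-assoc _ _ _ ⟩
        lower (F k) (suc x′) (suc (suc y′)) * (G k (suc x′) (suc (suc y′)) * F k (suc x′) (suc (suc y′)))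
                                 ≈⟨ *-congˡ (GF k x′ (suc y′) x′<p y′<q (inj₁ k<L)) ⟩
        lower (F k) (suc x′) (suc (suc y′)) * 1#
                                 ≈⟨ *-identityʳ _ ⟩
        lower (F k) (suc x′) (suc (suc y′)) ∎
        where
        g-reciprocal : b * g * a ≈ F k (suc x′) (suc (suc y′))
        g-reciprocal = unflip-inverse
          (GF ℓ x y x<p (ℕₚ.<⇒≤ y<q) (inj₁ ℓ<L)) (GF k x′ (suc y′) x′<p y′<q (inj₁ k<L))
          (rec₁ ℓ x x′ (suc y′) k x+x′ y+sy′ ≡.refl (ℕₚ.<⇒≤ ℓ<L))

      next : F (suc ℓ) (suc x) (suc (suc y)) ≈ a * G k (suc x′) (suc y′) * b
      next = flip-inverse
        (FG (suc ℓ) x (suc y) x<p y<q (inj₂ (≡.subst (0 <_) (≡.sym (ℕₚ.+-suc x y)) (s≤s z≤n) , ℓ<L)))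
        (FG k x′ y′ x′<p (ℕₚ.<⇒≤ y′<q) (inj₁ k<L))
        (begin
          g₂ * a                        ≈⟨ cancel-inverse b⁻¹b _ ⟨
          b⁻¹ * (b * (g₂ * a))          ≈⟨ *-congˡ (*-assoc _ _ _) ⟨
          b⁻¹ * (b * g₂ * a)            ≈⟨ *-congˡ (∙-cancelˡ (b * g₁ * a) _ _ sums) ⟩
          b⁻¹ * F k (suc x′) (suc y′)   ∎)
        where
        open import Algebra.Properties.Group +-group using (∙-cancelˡ)
        g₁ = G (suc ℓ) (suc (suc x)) (suc y)
        g₂ = G (suc ℓ) (suc x) (suc (suc y))
        sums : b * g₁ * a + b * g₂ * a ≈ b * g₁ * a + F k (suc x′) (suc y′)
        sums = begin
          b * g₁ * a + b * g₂ * a    ≈⟨ distribʳ _ _ _ ⟨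
          (b * g₁ + b * g₂) * a      ≈⟨ *-congʳ (distribˡ _ _ _) ⟨
          b * u * a                  ≈⟨ upper-reciprocal ⟩
          F k x′ (suc (suc y′)) + F k (suc x′) (suc y′)  ≈⟨ +-congʳ right-reciprocal ⟨
          b * g₁ * a + F k (suc x′) (suc y′)  ∎

    reciprocal : ∀ y → Reciprocal y
    reciprocal zero          = reciprocal₀
    reciprocal (suc zero)    = reciprocal₁
    reciprocal (suc (suc y)) ℓ x x′ y′ k x+x′ y+y′ e ℓ≤L =
      ≡.subst (λ ℓ → F ℓ (suc x) (suc (suc y)) ≈ _) e′
        (Step.next y (reciprocal y) (reciprocal (suc y)) k x x′ y′ x+x′ y+y′ (≡.subst (_≤ L) (≡.sym e′) ℓ≤L))
      where
      e′ : suc (k ℕ.+ x ℕ.+ suc y) ≡ ℓ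
      e′ = ≡.trans (≡.sym (ℕₚ.+-suc (k ℕ.+ x) (suc y))) e

-- Cover relations of the extended rectangle.

module Covers (P : FinitePoset) where
  open Extended P

  -- Opaque: conversion checking must not unfold the filters, whose decision procedures are large.
  opaque
    below above : P̂ → List P̂
    below = lowerCovers
    above = upperCovers

    below≡ : ∀ v → below v ≡ lowerCovers v
    below≡ v = ≡.refl

    above≡ : ∀ v → above v ≡ upperCovers v
    above≡ v = ≡.refl

    ∈-below : ∀ {u v} → u ∈ below v → u ⋖ v
    ∈-below {v = v} m = proj₂ (∈-filter⁻ (λ u → u ⋖? v) {xs = elements±} m)

    ∈-above⁻ : ∀ {u v} → u ∈ above v → v ⋖ u
    ∈-above⁻ {v = v} m = proj₂ (∈-filter⁻ (λ u → v ⋖? u) {xs = elements±} m)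

    ∈-above⁺ : ∀ {u v} → v ⋖ u → u ∈ above v
    ∈-above⁺ {v = v} = ∈-filter⁺ (λ u → v ⋖? u) (elements±-complete _)

module RectangleCovers (p q : ℕ) where
  P = rectangle (suc p) (suc q)
  open Extended P
  open Covers P

  private variable
    i x : Fin (suc p)
    j y : Fin (suc q)

  row column : P̂ → ℕ
  row [ i , _ ]    = toℕ i
  row _            = 0
  column [ _ , j ] = toℕ j
  column _         = 0

  lift≤ : x Fin.≤ i → y Fin.≤ j → [ x , y ] ≤± [ i , j ]
  lift≤ h k = [ h , k ]

  lower≤ : [ x , y ] ≤± [ i , j ] → x Fin.≤ i × y Fin.≤ j
  lower≤ h = [≤]-injective _ h

  below-⊥ : ∀ {u} → ¬ (u <± ⊥±)
  below-⊥ {⊥±} (_ , ne) = ne ≡.refl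
  below-⊥ {[ _ ]} (Sup.[ () ] , _)
  below-⊥ {⊤±} (() , _)

  above-⊤ : ∀ {u} → ¬ (⊤± <± u)
  above-⊤ {⊤±} (_ , ne) = ne ≡.refl
  above-⊤ {⊥±} (() , _)
  above-⊤ {[ _ ]} (() , _)

  ⊥<[] : ∀ {v} → ⊥± <± [ v ]
  ⊥<[] = (⊥±≤_) _ _ , λ ()

  []<⊤ : ∀ {v} → [ v ] <± ⊤±
  []<⊤ = (_≤⊤±) _ _ , λ ()

  cover₁ : suc (toℕ x) ≡ toℕ i → [ x , j ] ⋖ [ i , j ]
  cover₁ {x} {i} {j} e = (lift≤ (ℕₚ.≤-trans (ℕₚ.n≤1+n _) (ℕₚ.≤-reflexive e)) ℕₚ.≤-refl
                         , λ { ≡.refl → ℕₚ.1+n≢n e }) , between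
    where
    between : ¬ (Σ[ w ∈ P̂ ] [ x , j ] <± w × w <± [ i , j ])
    between (⊥± , h , _) = below-⊥ h
    between (⊤± , _ , h) = above-⊤ h
    between ([ w₁ , w₂ ] , (h , h≢) , (k , k≢)) with lower≤ h | lower≤ k
    ... | h₁ , h₂ | k₁ , k₂ with Finₚ.≤-antisym h₂ k₂ | toℕ x ℕ.≟ toℕ w₁
    ... | ≡.refl | yes x≡ = h≢ (≡.cong (λ z → [ z , w₂ ]) (Finₚ.toℕ-injective x≡))
    ... | ≡.refl | no  x≢ = k≢ (≡.cong (λ z → [ z , w₂ ]) (Finₚ.≤-antisym k₁
                              (≡.subst (_≤ toℕ w₁) e (ℕₚ.≤∧≢⇒< h₁ x≢))))

  cover₂ : suc (toℕ y) ≡ toℕ j → [ i , y ] ⋖ [ i , j ]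
  cover₂ {y} {j} {i} e = (lift≤ ℕₚ.≤-refl (ℕₚ.≤-trans (ℕₚ.n≤1+n _) (ℕₚ.≤-reflexive e))
                         , λ { ≡.refl → ℕₚ.1+n≢n e }) , between
    where
    between : ¬ (Σ[ w ∈ P̂ ] [ i , y ] <± w × w <± [ i , j ])
    between (⊥± , h , _) = below-⊥ h
    between (⊤± , _ , h) = above-⊤ h
    between ([ w₁ , w₂ ] , (h , h≢) , (k , k≢)) with lower≤ h | lower≤ k
    ... | h₁ , h₂ | k₁ , k₂ with Finₚ.≤-antisym h₁ k₁ | toℕ y ℕ.≟ toℕ w₂
    ... | ≡.refl | yes y≡ = h≢ (≡.cong (λ z → [ w₁ , z ]) (Finₚ.toℕ-injective y≡))
    ... | ≡.refl | no  y≢ = k≢ (≡.cong (λ z → [ w₁ , z ]) (Finₚ.≤-antisym k₂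
                              (≡.subst (_≤ toℕ w₂) e (ℕₚ.≤∧≢⇒< h₂ y≢))))

  private
    successor : ∀ {n} {x i : Fin n} → x Fin.< i → Σ[ w ∈ Fin n ] toℕ w ≡ suc (toℕ x)
    successor {i = i} x<i = fromℕ< (ℕₚ.≤-<-trans x<i (Finₚ.toℕ<n i)) , Finₚ.toℕ-fromℕ< _

  -- Raise by one a coordinate in which the two points differ. The result lies strictly above the
  -- smaller point and weakly below the larger, so having nothing strictly between forces it to be
  -- the larger point.
  cover-inv : [ x , y ] ⋖ [ i , j ] → (suc (toℕ x) ≡ toℕ i × y ≡ j) ⊎ (x ≡ i × suc (toℕ y) ≡ toℕ j)
  cover-inv {x} {y} {i} {j} ((h , h≢) , none) with lower≤ h
  ... | x≤i , y≤j with toℕ x ℕ.≟ toℕ i | toℕ y ℕ.≟ toℕ j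
  ... | yes x≡ | yes y≡ = contradiction
    (≡.cong₂ (λ u v → [ u , v ]) (Finₚ.toℕ-injective x≡) (Finₚ.toℕ-injective y≡)) h≢
  ... | no x≢ | _ = inj₁ (≡.trans (≡.sym w≡) (≡.cong toℕ (≡.cong proj₁ w≡v)) , ≡.cong proj₂ w≡v)
    where
    x<i = ℕₚ.≤∧≢⇒< x≤i x≢
    w = proj₁ (successor {x = x} {i} x<i)
    w≡ = proj₂ (successor {x = x} {i} x<i)
    w≡v : (w , y) ≡ (i , j)
    w≡v with [ w , y ] ≟± [ i , j ]
    ... | yes e = [_]-injective e
    ... | no w≢ = contradiction ([ w , y ] ,
      (lift≤ (ℕₚ.≤-trans (ℕₚ.n≤1+n _) (ℕₚ.≤-reflexive (≡.sym w≡))) ℕₚ.≤-refl ,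
        λ e → ℕₚ.1+n≢n (≡.trans (≡.sym w≡) (≡.sym (≡.cong row e)))) ,
      (lift≤ (≡.subst (_≤ toℕ i) (≡.sym w≡) x<i) y≤j , w≢)) none
  ... | yes x≡ | no y≢ = inj₂ (≡.cong proj₁ w≡v′ , ≡.trans (≡.sym w≡) (≡.cong toℕ (≡.cong proj₂ w≡v′)))
    where
    y<j = ℕₚ.≤∧≢⇒< y≤j y≢
    w = proj₁ (successor {x = y} {j} y<j)
    w≡ = proj₂ (successor {x = y} {j} y<j)
    w≡v′ : (x , w) ≡ (i , j)
    w≡v′ with [ x , w ] ≟± [ i , j ]
    ... | yes e = [_]-injective e
    ... | no w≢ = contradiction ([ x , w ] ,
      (lift≤ ℕₚ.≤-refl (ℕₚ.≤-trans (ℕₚ.n≤1+n _) (ℕₚ.≤-reflexive (≡.sym w≡))) ,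
        λ e → ℕₚ.1+n≢n (≡.trans (≡.sym w≡) (≡.sym (≡.cong column e)))) ,
      (lift≤ x≤i (≡.subst (_≤ toℕ j) (≡.sym w≡) y<j) , w≢)) none

  ⊥-cover : ⊥± ⋖ [ zero , zero ]
  ⊥-cover = ⊥<[] , λ { (⊥± , h , _) → below-⊥ h ; (⊤± , _ , h) → above-⊤ h
                     ; ([ w ] , _ , h , h≢) → h≢ (≡.cong₂ (λ u v → [ u , v ])
                         (Finₚ.≤-antisym (proj₁ (lower≤ h)) z≤n) (Finₚ.≤-antisym (proj₂ (lower≤ h)) z≤n)) }

  ⊥-cover-inv : ⊥± ⋖ [ i , j ] → (i , j) ≡ (zero , zero)
  ⊥-cover-inv {i} {j} (_ , none) with [ i , j ] ≟± [ zero , zero ]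
  ... | yes ≡.refl = ≡.refl
  ... | no ne = contradiction ([ zero , zero ] , ⊥<[] , lift≤ z≤n z≤n , λ e → ne (≡.sym e)) none

  top≤ : ∀ {n} (i x : Fin (suc n)) → toℕ i ≡ n → x Fin.≤ i
  top≤ i x e = ≡.subst (toℕ x ≤_) (≡.sym e) (ℕ.s≤s⁻¹ (Finₚ.toℕ<n x))

  ⊤-cover : toℕ i ≡ p → toℕ j ≡ q → [ i , j ] ⋖ ⊤±
  ⊤-cover {i} {j} i≡ j≡ = []<⊤ , λ { (⊥± , h , _) → below-⊥ h ; (⊤± , _ , h) → above-⊤ h
    ; ([ x , y ] , (h , h≢) , _) → h≢ (≡.cong₂ (λ u v → [ u , v ])
        (Finₚ.≤-antisym (proj₁ (lower≤ h)) (top≤ i x i≡)) (Finₚ.≤-antisym (proj₂ (lower≤ h)) (top≤ j y j≡))) }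

  ⊤-cover-inv : [ i , j ] ⋖ ⊤± → toℕ i ≡ p × toℕ j ≡ q
  ⊤-cover-inv {i} {j} (_ , none) with [ i , j ] ≟± [ Fin.fromℕ p , Fin.fromℕ q ]
  ... | yes ≡.refl = Finₚ.toℕ-fromℕ p , Finₚ.toℕ-fromℕ q
  ... | no ne = contradiction ([ Fin.fromℕ p , Fin.fromℕ q ] , (lift≤ (Finₚ.≤fromℕ i) (Finₚ.≤fromℕ j) , ne) , []<⊤) none

  elements±-unique : Unique elements±
  elements±-unique = ((λ ()) ∷ Allₚ.map⁺ (All.universal (λ _ ()) _))
                   ∷ Allₚ.map⁺ (All.universal (λ _ ()) _)
                   ∷ Uniqueₚ.map⁺ (λ { ≡.refl → ≡.refl }) (FinitePoset.elements-unique P)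

  -- Evaluating the filter for general sides is avoided: two duplicate-free lists with the same
  -- members are permutations of each other, which suffices for sums.
  covers-↭ : ∀ {R : P̂ → Set} (R? : ∀ u → Dec (R u)) {us : List P̂} →
             Unique us → (∀ {u} → R u → u ∈ us) → All R us → filter R? elements± ↭ us
  covers-↭ R? unique to from = ∼bag⇒↭ (unique∧set⇒bag (Uniqueₚ.filter⁺ R? elements±-unique) unique
    (mk⇔ (λ m → to (proj₂ (∈-filter⁻ R? m)))
         (λ m → ∈-filter⁺ R? (elements±-complete _) (All.lookup from m))))

  lowers : Fin (suc p) → Fin (suc q) → List P̂
  lowers zero    zero    = ⊥± ∷ []
  lowers zero    (suc j) = [ zero , inject₁ j ] ∷ []
  lowers (suc i) zero    = [ inject₁ i , zero ] ∷ []
  lowers (suc i) (suc j) = [ inject₁ i , suc j ] ∷ [ suc i , inject₁ j ] ∷ []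

  private
    pred-unique : ∀ {n} {x : Fin (suc n)} {i : Fin n} → suc (toℕ x) ≡ suc (toℕ i) → x ≡ inject₁ i
    pred-unique {i = i} e = Finₚ.toℕ-injective (≡.trans (ℕₚ.suc-injective e) (≡.sym (Finₚ.toℕ-inject₁ i)))

    suc-inject₁ : ∀ {n} (i : Fin n) → suc (toℕ (inject₁ i)) ≡ suc (toℕ i)
    suc-inject₁ i = ≡.cong ℕ.suc (Finₚ.toℕ-inject₁ i)

  below-↭ : ∀ i j → below [ i , j ] ↭ lowers i j
  below-↭ i j = ≡.subst (_↭ lowers i j) (≡.sym (below≡ [ i , j ]))
    (covers-↭ (λ u → u ⋖? [ i , j ]) (unique i j) (to i j) (from i j))
    where
    unique : ∀ i j → Unique (lowers i j)
    unique zero    zero    = [] ∷ []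
    unique zero    (suc j) = [] ∷ []
    unique (suc i) zero    = [] ∷ []
    unique (suc i) (suc j) =
      ((λ e → ℕₚ.1+n≢n (≡.trans (≡.sym (≡.cong row e)) (Finₚ.toℕ-inject₁ i))) ∷ []) ∷ [] ∷ []
    from : ∀ i j → All (_⋖ [ i , j ]) (lowers i j)
    from zero    zero    = ⊥-cover ∷ []
    from zero    (suc j) = cover₂ (suc-inject₁ j) ∷ []
    from (suc i) zero    = cover₁ (suc-inject₁ i) ∷ []
    from (suc i) (suc j) = cover₁ (suc-inject₁ i) ∷ cover₂ (suc-inject₁ j) ∷ []
    to : ∀ i j {u} → u ⋖ [ i , j ] → u ∈ lowers i j
    to i j {⊤±} (h , _) = contradiction h above-⊤
    to i j {⊥±} h with ≡.refl ← ⊥-cover-inv h = here ≡.refl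
    to i j {[ x , y ]} h with cover-inv h
    to zero    _       {[ x , y ]} h | inj₁ (() , _)
    to (suc i) zero    {[ x , y ]} h | inj₁ (e , ≡.refl) with ≡.refl ← pred-unique e = here ≡.refl
    to (suc i) (suc j) {[ x , y ]} h | inj₁ (e , ≡.refl) with ≡.refl ← pred-unique e = here ≡.refl
    to _       zero    {[ x , y ]} h | inj₂ (_ , ())
    to zero    (suc j) {[ x , y ]} h | inj₂ (≡.refl , e) with ≡.refl ← pred-unique e = here ≡.refl
    to (suc i) (suc j) {[ x , y ]} h | inj₂ (≡.refl , e) with ≡.refl ← pred-unique e = there (here ≡.refl)

  uppers : (i : Fin (suc p)) (j : Fin (suc q)) →
           Dec (suc (toℕ i) < suc p) → Dec (suc (toℕ j) < suc q) → List P̂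
  uppers i j (yes i<p) (yes j<q) = [ fromℕ< i<p , j ] ∷ [ i , fromℕ< j<q ] ∷ []
  uppers i j (yes i<p) (no  _)   = [ fromℕ< i<p , j ] ∷ []
  uppers i j (no  _)   (yes j<q) = [ i , fromℕ< j<q ] ∷ []
  uppers i j (no  _)   (no  _)   = ⊤± ∷ []

  private
    succ≡ : ∀ {n} {x i : Fin n} (lt : suc (toℕ i) < n) → suc (toℕ i) ≡ toℕ x → x ≡ fromℕ< lt
    succ≡ lt e = Finₚ.toℕ-injective (≡.trans (≡.sym e) (≡.sym (Finₚ.toℕ-fromℕ< lt)))

    succ< : ∀ {n} {x i : Fin n} → suc (toℕ i) ≡ toℕ x → suc (toℕ i) < n
    succ< {n} {x} e = ≡.subst (_< n) (≡.sym e) (Finₚ.toℕ<n x)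

  last≡ : ∀ {n} (i : Fin (suc n)) → ¬ (suc (toℕ i) < suc n) → toℕ i ≡ n
  last≡ i ≮ = ℕₚ.≤-antisym (ℕ.s≤s⁻¹ (Finₚ.toℕ<n i)) (ℕ.s≤s⁻¹ (ℕₚ.≮⇒≥ ≮))

  above-↭ : ∀ i j (di : Dec (suc (toℕ i) < suc p)) (dj : Dec (suc (toℕ j) < suc q)) →
                  above [ i , j ] ↭ uppers i j di dj
  above-↭ i j di dj = ≡.subst (_↭ uppers i j di dj) (≡.sym (above≡ [ i , j ]))
    (covers-↭ (λ u → [ i , j ] ⋖? u) (unique di dj) (to di dj) (from di dj))
    where
    unique : ∀ di dj → Unique (uppers i j di dj)
    unique (yes i<p) (yes j<q) =
      ((λ e → ℕₚ.1+n≢n (≡.trans (≡.sym (Finₚ.toℕ-fromℕ< i<p)) (≡.cong row e))) ∷ []) ∷ [] ∷ []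
    unique (yes i<p) (no  _)   = [] ∷ []
    unique (no  _)   (yes j<q) = [] ∷ []
    unique (no  _)   (no  _)   = [] ∷ []
    cov₁ : ∀ i<p → [ i , j ] ⋖ [ fromℕ< i<p , j ]
    cov₁ i<p = cover₁ (≡.sym (Finₚ.toℕ-fromℕ< i<p))
    cov₂ : ∀ j<q → [ i , j ] ⋖ [ i , fromℕ< j<q ]
    cov₂ j<q = cover₂ (≡.sym (Finₚ.toℕ-fromℕ< j<q))
    from : ∀ di dj → All ([ i , j ] ⋖_) (uppers i j di dj)
    from (yes i<p) (yes j<q) = cov₁ i<p ∷ cov₂ j<q ∷ []
    from (yes i<p) (no  _)   = cov₁ i<p ∷ []
    from (no  _)   (yes j<q) = cov₂ j<q ∷ []
    from (no  i≮p) (no  j≮q) = ⊤-cover (last≡ i i≮p) (last≡ j j≮q) ∷ []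
    to : ∀ di dj {u} → [ i , j ] ⋖ u → u ∈ uppers i j di dj
    to _ _ {⊥±} (h , _) = contradiction h below-⊥
    to di dj {⊤±} h with ⊤-cover-inv h
    to (yes i<p) _         {⊤±} h | i≡ , _ = contradiction (≡.cong suc i≡) (ℕₚ.<⇒≢ i<p)
    to (no _)    (yes j<q) {⊤±} h | _ , j≡ = contradiction (≡.cong suc j≡) (ℕₚ.<⇒≢ j<q)
    to (no _)    (no _)    {⊤±} h | _      = here ≡.refl
    to di dj {[ x , y ]} h with cover-inv h
    to (yes i<p) (yes j<q) {[ x , y ]} h | inj₁ (e , ≡.refl) = here (≡.cong (λ z → [ z , j ]) (succ≡ i<p e))
    to (yes i<p) (no _)    {[ x , y ]} h | inj₁ (e , ≡.refl) = here (≡.cong (λ z → [ z , j ]) (succ≡ i<p e))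
    to (no i≮p)  _         {[ x , y ]} h | inj₁ (e , ≡.refl) = contradiction (succ< {x = x} e) i≮p
    to (yes i<p) (yes j<q) {[ x , y ]} h | inj₂ (≡.refl , e) = there (here (≡.cong (λ z → [ i , z ]) (succ≡ j<q e)))
    to (no _)    (yes j<q) {[ x , y ]} h | inj₂ (≡.refl , e) = here (≡.cong (λ z → [ i , z ]) (succ≡ j<q e))
    to _         (no j≮q)  {[ x , y ]} h | inj₂ (≡.refl , e) = contradiction (succ< {x = y} e) j≮q

-- Neighbour sums of labelings as sums in padded grids.

module Padding {c r} (K : Ring c r) (p q : ℕ) where
  open Ring K hiding (zero)
  open Lattice K
  open RectangleCovers p q
  open Extended P
  open Covers P

  sum-↭ : ∀ (h : P̂ → Carrier) {us ws} → us ↭ ws → sum K (map h us) ≈ sum K (map h ws)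
  sum-↭ h e = ↭ₛ.foldr-commMonoid setoid +-isCommutativeMonoid (↭⇒↭ₛ′ isEquivalence (map⁺ h e))

  entry : (P̂ → Carrier) → Grid
  entry h x y with x <? suc p | y <? suc q
  ... | yes x<p | yes y<q = h [ fromℕ< x<p , fromℕ< y<q ]
  ... | _       | _       = 0#

  entry-toℕ : ∀ h i j → entry h (toℕ i) (toℕ j) ≡ h [ i , j ]
  entry-toℕ h i j with toℕ i <? suc p | toℕ j <? suc q
  ... | yes x<p | yes y<q = ≡.cong₂ (λ u v → h [ u , v ]) (Finₚ.fromℕ<-toℕ i x<p) (Finₚ.fromℕ<-toℕ j y<q)
  ... | yes _   | no  y≮q = contradiction (Finₚ.toℕ<n j) y≮q
  ... | no  x≮p | _       = contradiction (Finₚ.toℕ<n i) x≮p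

  entry≡ : ∀ h i j {x y} → toℕ i ≡ x → toℕ j ≡ y → h [ i , j ] ≈ entry h x y
  entry≡ h i j ≡.refl ≡.refl = reflexive (≡.sym (entry-toℕ h i j))

  entry-outside : ∀ h x y → ¬ (x < suc p × y < suc q) → entry h x y ≈ 0#
  entry-outside h x y out with x <? suc p | y <? suc q
  ... | yes x<p | yes y<q = contradiction (x<p , y<q) out
  ... | yes _   | no  _   = refl
  ... | no  _   | _       = refl

  -- The extremal label sits at only one of the two outer neighbours of its corner, so that the
  -- corner sum counts it once.
  padBelow padAbove : (P̂ → Carrier) → Grid
  padBelow h (suc x)       (suc y) = entry h x y
  padBelow h (suc zero)    zero    = h ⊥±
  padBelow h (suc (suc _)) zero    = 0#
  padBelow h zero          _       = 0#

  padAbove g (suc x) (suc y) with x ℕ.≟ p | y ℕ.≟ suc q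
  ... | yes _ | yes _ = g ⊤±
  ... | _     | _     = entry g x y
  padAbove g _ _ = 0#

  padAbove-corner : ∀ g → padAbove g (suc p) (suc (suc q)) ≈ g ⊤±
  padAbove-corner g with p ℕ.≟ p | suc q ℕ.≟ suc q
  ... | yes _ | yes _ = refl
  ... | yes _ | no ne = contradiction ≡.refl ne
  ... | no ne | _     = contradiction ≡.refl ne

  padAbove-entry : ∀ g x y → ¬ (x ≡ p × y ≡ suc q) → padAbove g (suc x) (suc y) ≈ entry g x y
  padAbove-entry g x y ne with x ℕ.≟ p | y ℕ.≟ suc q
  ... | yes x≡ | yes y≡ = contradiction (x≡ , y≡) ne
  ... | yes _  | no _   = refl
  ... | no _   | _      = refl

  padAbove-right : ∀ g y → padAbove g (suc (suc p)) y ≈ 0#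
  padAbove-right g zero    = refl
  padAbove-right g (suc y) = trans (padAbove-entry g (suc p) y (λ (e , _) → ℕₚ.1+n≢n e))
                                   (entry-outside g (suc p) y (λ (lt , _) → ℕₚ.<-irrefl ≡.refl lt))

  padAbove-top : ∀ g x → x ≢ suc p → padAbove g x (suc (suc q)) ≈ 0#
  padAbove-top g zero    _  = refl
  padAbove-top g (suc x) x≢ = trans (padAbove-entry g x (suc q) (λ (e , _) → x≢ (≡.cong suc e)))
                                    (entry-outside g x (suc q) (λ (_ , lt) → ℕₚ.<-irrefl ≡.refl lt))

  sum-below : ∀ h i j → sum K (map h (below [ i , j ])) ≈ lower (padBelow h) (suc (toℕ i)) (suc (toℕ j))
  sum-below h i j = trans (sum-↭ h (below-↭ i j)) (explicit i j)
    where
    explicit : ∀ i j → sum K (map h (lowers i j)) ≈ lower (padBelow h) (suc (toℕ i)) (suc (toℕ j))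
    explicit zero    zero    = +-comm _ _
    explicit zero    (suc j) = trans (+-comm _ _) (+-congˡ (entry≡ h zero (inject₁ j) ≡.refl (Finₚ.toℕ-inject₁ j)))
    explicit (suc i) zero    = +-congʳ (entry≡ h (inject₁ i) zero (Finₚ.toℕ-inject₁ i) ≡.refl)
    explicit (suc i) (suc j) = +-cong (entry≡ h (inject₁ i) (suc j) (Finₚ.toℕ-inject₁ i) ≡.refl)
      (trans (+-identityʳ _) (entry≡ h (suc i) (inject₁ j) ≡.refl (Finₚ.toℕ-inject₁ j)))

  sum-above : ∀ g i j → sum K (map g (above [ i , j ])) ≈ upper (padAbove g) (suc (toℕ i)) (suc (toℕ j))
  sum-above g i j = trans (sum-↭ g (above-↭ i j di dj)) (explicit di dj)
    where
    di = suc (toℕ i) <? suc p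
    dj = suc (toℕ j) <? suc q
    right : (i<p : suc (toℕ i) < suc p) → g [ fromℕ< i<p , j ] ≈ padAbove g (suc (suc (toℕ i))) (suc (toℕ j))
    right i<p = trans (entry≡ g (fromℕ< i<p) j (Finₚ.toℕ-fromℕ< i<p) ≡.refl)
                      (sym (padAbove-entry g (suc (toℕ i)) (toℕ j) (λ (_ , e) → ℕₚ.<⇒≢ (Finₚ.toℕ<n j) e)))
    aboveᵢ : (j<q : suc (toℕ j) < suc q) → g [ i , fromℕ< j<q ] ≈ padAbove g (suc (toℕ i)) (suc (suc (toℕ j)))
    aboveᵢ j<q = trans (entry≡ g i (fromℕ< j<q) ≡.refl (Finₚ.toℕ-fromℕ< j<q))
                      (sym (padAbove-entry g (toℕ i) (suc (toℕ j)) (λ (_ , e) → ℕₚ.<⇒≢ j<q e)))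
    right-end : ¬ (suc (toℕ i) < suc p) → padAbove g (suc (suc (toℕ i))) (suc (toℕ j)) ≈ 0#
    right-end i≮p = trans
      (reflexive (≡.cong (λ z → padAbove g (suc (suc z)) (suc (toℕ j))) (last≡ i i≮p)))
      (padAbove-right g (suc (toℕ j)))
    explicit : ∀ di dj → sum K (map g (uppers i j di dj)) ≈ upper (padAbove g) (suc (toℕ i)) (suc (toℕ j))
    explicit (yes i<p) (yes j<q) = +-cong (right i<p) (trans (+-identityʳ _) (aboveᵢ j<q))
    explicit (yes i<p) (no  j≮q) = +-cong (right i<p) (sym (trans
      (reflexive (≡.cong (λ z → padAbove g (suc (toℕ i)) (suc (suc z))) (last≡ j j≮q)))
      (padAbove-top g (suc (toℕ i)) (ℕₚ.<⇒≢ i<p))))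
    explicit (no  i≮p) (yes j<q) = trans (+-comm _ _) (+-cong (sym (right-end i≮p)) (aboveᵢ j<q))
    explicit (no  i≮p) (no  j≮q) = trans (+-comm _ _) (+-cong (sym (right-end i≮p)) (sym (trans
      (reflexive (≡.cong₂ (λ x y → padAbove g (suc x) (suc (suc y))) (last≡ i i≮p) (last≡ j j≮q)))
      (padAbove-corner g))))

-- Rowmotion along a linear extension as a system of toggle equations.

module Rowmotion {c r} (K : Ring c r) (P : FinitePoset) where
  open Ring K hiding (zero)
  open Extended P
  open Covers P
  open FinitePoset P using () renaming (Carrier to V; _<_ to _<ₚ_)

  Inv : Carrier → Set (c Level.⊔ r)
  Inv = Invertible _≈_ 1# _*_

  -- The neighbour labels are free lists, so that the lower ones can be taken from the old labeling
  -- and the upper ones from the new.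
  Toggled : Carrier → List Carrier → List Carrier → Carrier → Set (c Level.⊔ r)
  Toggled x ls us y =
    Σ[ x⁻¹ ∈ Inv x ] Σ[ d ∈ Defined (sumOfInverses K us) ]
    Σ[ S⁻¹ ∈ Inv (value (sumOfInverses K us) d) ] y ≡ sum K ls * proj₁ x⁻¹ * proj₁ S⁻¹

  Follows : V → V → Set
  Follows v w = v ≢ w × ¬ (w <ₚ v)

  update-same : ∀ (f : Labeling K P) v x → _[_≔_] K P f v x v ≡ x
  update-same f v x with v ≟± v
  ... | yes _ = ≡.refl
  ... | no ne = contradiction ≡.refl ne

  update-other : ∀ (f : Labeling K P) v x w → w ≢ v → _[_≔_] K P f v x w ≡ f w
  update-other f v x w ne with w ≟± v
  ... | yes e = contradiction e ne
  ... | no _  = ≡.refl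

  covers⇒< : ∀ {v w} → [ v ] ⋖ [ w ] → v <ₚ w
  covers⇒< ((h , ne) , _) = [≤]-injective _ h , λ e → ne (≡.cong [_] e)

  toggle-untouched : ∀ v h (e : Defined (toggle K P v h)) u → u ≢ [ v ] → value (toggle K P v h) e u ≡ h u
  toggle-untouched v h _ u = update-other h [ v ] _ u

  toggle-toggled : ∀ v h (e : Defined (toggle K P v h)) →
    Toggled (h [ v ]) (map h (below [ v ])) (map h (above [ v ])) (value (toggle K P v h) e [ v ])
  toggle-toggled v h (x⁻¹ , s , S⁻¹ , _) rewrite below≡ [ v ] | above≡ [ v ] =
    x⁻¹ , s , S⁻¹ , update-same h [ v ] _

  module _ (f : Labeling K P) where

    rowmotion-untouched : ∀ vs (d : Defined (rowmotion K P vs f)) u → (∀ v → v ∈ vs → u ≢ [ v ]) →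
                          value (rowmotion K P vs f) d u ≡ f u
    rowmotion-untouched []       _       u _ = ≡.refl
    rowmotion-untouched (v ∷ vs) (d , e) u h =
      ≡.trans (toggle-untouched v _ e u (h v (here ≡.refl)))
              (rowmotion-untouched vs d u (λ w w∈ → h w (there w∈)))

    -- Toggles act from the end of the list. When `v` is toggled, its lower covers have not been
    -- touched yet and its upper covers will not be touched again: the former still carry `f`, the
    -- latter already carry `g`.
    rowmotion-toggled : ∀ vs → AllPairs Follows vs → (d : Defined (rowmotion K P vs f)) →
      let g = value (rowmotion K P vs f) d in
      ∀ v → v ∈ vs → Toggled (f [ v ]) (map f (below [ v ])) (map g (above [ v ])) (g [ v ])
    rowmotion-toggled (v ∷ vs) (v-first ∷ pairs) (d , e) .v (here ≡.refl) = subst-Toggled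
      (h-untouched [ v ] (λ w w∈ e → proj₁ (All.lookup v-first w∈) ([_]-injective e)))
      (map-cong-local (All.tabulate (λ {u} u∈ → h-untouched u (λ { w w∈ ≡.refl →
        proj₂ (All.lookup v-first w∈) (covers⇒< (∈-below u∈)) }))))
      (map-cong-local (All.tabulate (λ {u} u∈ → ≡.sym (toggle-untouched v h e u
        (λ { ≡.refl → proj₂ (covers⇒< (∈-above⁻ u∈)) ≡.refl })))))
      (toggle-toggled v h e)
      where
      h = value (rowmotion K P vs f) d
      h-untouched = rowmotion-untouched vs d
      subst-Toggled : ∀ {x x′ ls ls′ us us′ y} → x ≡ x′ → ls ≡ ls′ → us ≡ us′ →
                      Toggled x ls us y → Toggled x′ ls′ us′ y
      subst-Toggled ≡.refl ≡.refl ≡.refl t = t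
    rowmotion-toggled (v ∷ vs) (v-first ∷ pairs) (d , e) w (there w∈) = ≡.subst₂
      (Toggled (f [ w ]) (map f (below [ w ])))
      (map-cong-local (All.tabulate (λ {u} u∈ → ≡.sym (toggle-untouched v h e u
        (λ { ≡.refl → proj₂ (All.lookup v-first w∈) (covers⇒< (∈-above⁻ u∈)) })))))
      (≡.sym (toggle-untouched v h e [ w ] (λ e → proj₁ (All.lookup v-first w∈) (≡.sym ([_]-injective e)))))
      (rowmotion-toggled vs pairs d w w∈)
      where
      h = value (rowmotion K P vs f) d

  AllPairs-lookup : ∀ {a ℓ} {A : Set a} {R : A → A → Set ℓ} (xs : List A) →
    (∀ i j → i Fin.< j → R (lookup xs i) (lookup xs j)) → AllPairs R xs
  AllPairs-lookup []       h = []
  AllPairs-lookup {R = R} (x ∷ xs) h =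
    All.tabulate (λ {y} y∈ → ≡.subst (R x) (≡.sym (Anyₚ.lookup-index y∈)) (h zero (suc (Any.index y∈)) (s≤s z≤n)))
    ∷ AllPairs-lookup xs (λ i j i<j → h (suc i) (suc j) (s≤s i<j))

  linearExtension-follows : ∀ {vs} → IsLinearExtension P vs → AllPairs Follows vs
  linearExtension-follows {vs} ext = AllPairs.zip
    (unique , AllPairs-lookup vs (λ i j i<j lt → Finₚ.<-asym i<j (monotone j i lt)))
    where open IsLinearExtension ext

  Invertible-sumOfInverses : ∀ (h : P̂ → Carrier) us → Defined (sumOfInverses K (map h us)) → ∀ {u} → u ∈ us → Inv (h u)
  Invertible-sumOfInverses h (u ∷ us) (u⁻¹ , _)     (here ≡.refl) = u⁻¹
  Invertible-sumOfInverses h (u ∷ us) (_ , d , _) (there u∈)    = Invertible-sumOfInverses h us d u∈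

  inverse-unique : ∀ {x y z} → y * x ≈ 1# → x * z ≈ 1# → y ≈ z
  inverse-unique {x} {y} {z} yx xz = trans (sym (*-identityʳ y)) (trans (*-congˡ (sym xz))
    (trans (sym (*-assoc y x z)) (trans (*-congʳ yx) (*-identityˡ z))))

  value-sumOfInverses : ∀ (g h : P̂ → Carrier) us (d : Defined (sumOfInverses K (map h us))) →
    (∀ {u} → u ∈ us → g u * h u ≈ 1#) → value (sumOfInverses K (map h us)) d ≈ sum K (map g us)
  value-sumOfInverses g h []       _ _ = refl
  value-sumOfInverses g h (u ∷ us) ((_ , _ , right) , d , _) gh =
    +-cong (sym (inverse-unique (gh (here ≡.refl)) right)) (value-sumOfInverses g h us d (λ u∈ → gh (there u∈)))

  Toggled-transition : ∀ {x ls us y x⁻¹ S} → Toggled x ls us y → (∀ d → value (sumOfInverses K us) d ≈ S) →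
                       x⁻¹ * x ≈ 1# → y * S ≈ sum K ls * x⁻¹
  Toggled-transition {ls = ls} {us} {y} {x⁻¹} {S} ((z , _ , xz≈1) , d , (S⁻¹ , S⁻¹S≈1 , _) , eq) S≈ x⁻¹x≈1 = begin
    y * S                                           ≈⟨ *-cong (reflexive eq) (sym (S≈ d)) ⟩
    sum K ls * z * S⁻¹ * value (sumOfInverses K us) d  ≈⟨ *-assoc _ _ _ ⟩
    sum K ls * z * (S⁻¹ * value (sumOfInverses K us) d)  ≈⟨ *-congˡ S⁻¹S≈1 ⟩
    sum K ls * z * 1#                               ≈⟨ *-identityʳ _ ⟩
    sum K ls * z                                    ≈⟨ *-congˡ (inverse-unique x⁻¹x≈1 xz≈1) ⟨
    sum K ls * x⁻¹                                  ∎
    where open import Relation.Binary.Reasoning.Setoid setoid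

  -- Makes the family of inverses total: 0 is a placeholder at times and places where invertibility
  -- is not established.
  inverseOrZero : ∀ {ℓ} {Q : Set ℓ} {x} → Dec Q → (Q → Inv x) → Carrier
  inverseOrZero (yes k) inv = proj₁ (inv k)
  inverseOrZero (no  _) _   = 0#

  inverseOrZero-inverse : ∀ {ℓ} {Q : Set ℓ} {x} (Q? : Dec Q) (inv : Q → Inv x) → Q →
    inverseOrZero Q? inv * x ≈ 1# × x * inverseOrZero Q? inv ≈ 1#
  inverseOrZero-inverse (yes k) inv _ = proj₂ (inv k)
  inverseOrZero-inverse (no ¬k) _   k = contradiction k ¬k

-- Orbits of partial maps.

module Trajectory {a s} {X : Set a} (R : X → Partial X s) (f : X) where

  -- All iterates are read off from one piece of evidence, so consecutive ones match up to `≡`;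
  -- separately chosen evidence could give different representatives. The sequence is constant from
  -- time `L` on.
  orbit : ∀ L → Defined ((R ^ₚ L) f) → ℕ → X
  orbit zero    _       _ = f
  orbit (suc L) (d , e) ℓ with ℓ ≤? L
  ... | yes _ = orbit L d ℓ
  ... | no  _ = value (R (value ((R ^ₚ L) f) d)) e

  orbit-last : ∀ L d → orbit L d L ≡ value ((R ^ₚ L) f) d
  orbit-last zero    _       = ≡.refl
  orbit-last (suc L) (d , e) with suc L ≤? L
  ... | yes L<L = contradiction L<L (ℕₚ.<-irrefl ≡.refl)
  ... | no  _   = ≡.refl

  orbit-defined : ∀ L d ℓ → ℓ ≤ L → Σ[ d′ ∈ Defined ((R ^ₚ ℓ) f) ] value ((R ^ₚ ℓ) f) d′ ≡ orbit L d ℓ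
  orbit-defined zero    d       zero _   = d , ≡.refl
  orbit-defined (suc L) (d , e) ℓ    ℓ≤L with ℓ ≤? L
  ... | yes ℓ≤L′ = orbit-defined L d ℓ ℓ≤L′
  ... | no  ℓ≰L  with ≡.refl ← ℕₚ.≤-antisym ℓ≤L (ℕₚ.≰⇒> ℓ≰L) = (d , e) , ≡.refl

  orbit-step : ∀ L d ℓ → ℓ < L → Σ[ e ∈ Defined (R (orbit L d ℓ)) ] value (R (orbit L d ℓ)) e ≡ orbit L d (suc ℓ)
  orbit-step (suc L) (d , e) ℓ (s≤s ℓ≤L) with ℓ ≤? L | suc ℓ ≤? L
  ... | no ℓ≰L | _       = contradiction ℓ≤L ℓ≰L
  ... | yes _  | yes ℓ<L = orbit-step L d ℓ ℓ<L
  ... | yes _  | no ℓ≮L  with ≡.refl ← ℕₚ.≤-antisym ℓ≤L (ℕₚ.≮⇒≥ ℓ≮L) = at-end (orbit-last L d)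
    where
    at-end : ∀ {x} → x ≡ value ((R ^ₚ L) f) d →
             Σ[ e′ ∈ Defined (R x) ] value (R x) e′ ≡ value (R (value ((R ^ₚ L) f) d)) e
    at-end ≡.refl = e , ≡.refl

  orbit-invariant : ∀ {b} {B : Set b} (φ : X → B) → (∀ x d → φ (value (R x) d) ≡ φ x) →
                    ∀ L d ℓ → φ (orbit L d ℓ) ≡ φ f
  orbit-invariant φ inv zero    d       ℓ = ≡.refl
  orbit-invariant φ inv (suc L) (d , e) ℓ with ℓ ≤? L
  ... | yes _ = orbit-invariant φ inv L d ℓ
  ... | no  _ = ≡.trans (inv _ e) (≡.trans (≡.cong φ (≡.sym (orbit-last L d))) (orbit-invariant φ inv L d L))

-- Invertibility along the orbit, and reciprocity for the rectangle.

module RectangleReciprocity {c r} (K : Ring c r) (p q : ℕ)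
  (vs : List (Fin (suc p) × Fin (suc q))) (ext : IsLinearExtension (rectangle (suc p) (suc q)) vs)
  (f : Labeling K (rectangle (suc p) (suc q))) (L : ℕ)
  (d : Defined ((rowmotion K (rectangle (suc p) (suc q)) vs ^ₚ suc L) f))
  where
  open Ring K hiding (zero)
  open Lattice K
  open RectangleCovers p q
  open Extended P
  open Covers P
  open Padding K p q
  open Rowmotion K P
  open Trajectory (rowmotion K P vs) f
  open import Relation.Binary.Reasoning.Setoid setoid

  h : ℕ → Labeling K P
  h = orbit (suc L) d

  h-fixed : ∀ u → (∀ v → u ≢ [ v ]) → ∀ ℓ → h ℓ u ≡ f u
  h-fixed u u≢ = orbit-invariant (λ x → x u) (λ x e → rowmotion-untouched x vs e u (λ v _ → u≢ v)) (suc L) d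

  step : ∀ ℓ → ℓ < suc L → ∀ v →
         Toggled (h ℓ [ v ]) (map (h ℓ) (below [ v ])) (map (h (suc ℓ)) (above [ v ])) (h (suc ℓ) [ v ])
  step ℓ ℓ<L v = ≡.subst (λ g → Toggled (h ℓ [ v ]) (map (h ℓ) (below [ v ])) (map g (above [ v ])) (g [ v ]))
    (proj₂ e,eq)
    (rowmotion-toggled (h ℓ) vs (linearExtension-follows ext) (proj₁ e,eq) v (IsLinearExtension.complete ext v))
    where e,eq = orbit-step (suc L) d ℓ ℓ<L

  upper-Inv : ∀ ℓ → ℓ < suc L → ∀ {u} v → [ v ] ⋖ u → Inv (h (suc ℓ) u)
  upper-Inv ℓ ℓ<L v v⋖u = Invertible-sumOfInverses (h (suc ℓ)) (above [ v ]) (proj₁ (proj₂ (step ℓ ℓ<L v)))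
    (∈-above⁺ v⋖u)

  Known : ℕ → ℕ → ℕ → Set
  Known ℓ x y = ℓ < suc L ⊎ (0 < x ℕ.+ y × ℓ ≤ suc L)

  -- Before the final time the next toggle at (`i`, `j`) inverts this label. At a positive time, a
  -- point other than the minimal one covers some point of the rectangle, and the toggle there has
  -- just inverted its label.
  known-Inv : ∀ ℓ i j → Known ℓ (toℕ i) (toℕ j) → Inv (h ℓ [ i , j ])
  known-Inv ℓ i j (inj₁ ℓ<L) = proj₁ (step ℓ ℓ<L (i , j))
  known-Inv zero    i j (inj₂ _) = proj₁ (step 0 (s≤s z≤n) (i , j))
  known-Inv (suc ℓ) (suc i) j (inj₂ (_ , ℓ<L)) =
    upper-Inv ℓ ℓ<L (inject₁ i , j) (cover₁ (≡.cong ℕ.suc (Finₚ.toℕ-inject₁ i)))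
  known-Inv (suc ℓ) zero (suc j) (inj₂ (_ , ℓ<L)) =
    upper-Inv ℓ ℓ<L (zero , inject₁ j) (cover₂ (≡.cong ℕ.suc (Finₚ.toℕ-inject₁ j)))

  known? : ∀ ℓ x y → Dec (Known ℓ x y)
  known? ℓ x y = (ℓ <? suc L) ⊎-dec ((0 <? x ℕ.+ y) ×-dec (ℓ ≤? suc L))

  -- The toggle at the maximal point inverts `b`; the first step of rowmotion contains it, and there
  -- is one because the number of steps is `suc L`.
  ⊤-Inv : Inv (f ⊤±)
  ⊤-Inv = ≡.subst Inv (h-fixed ⊤± (λ _ ()) 1)
    (upper-Inv 0 (s≤s z≤n) (Fin.fromℕ p , Fin.fromℕ q) (⊤-cover (Finₚ.toℕ-fromℕ p) (Finₚ.toℕ-fromℕ q)))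

  g : ℕ → P̂ → Carrier
  g ℓ ⊥± = 0#
  g ℓ ⊤± = proj₁ ⊤-Inv
  g ℓ [ i , j ] = inverseOrZero (known? ℓ (toℕ i) (toℕ j)) (known-Inv ℓ i j)

  g-inverse : ∀ ℓ i j → Known ℓ (toℕ i) (toℕ j) →
              g ℓ [ i , j ] * h ℓ [ i , j ] ≈ 1# × h ℓ [ i , j ] * g ℓ [ i , j ] ≈ 1#
  g-inverse ℓ i j = inverseOrZero-inverse (known? ℓ (toℕ i) (toℕ j)) (known-Inv ℓ i j)

  g-upper : ∀ ℓ → ℓ < suc L → ∀ v {u} → [ v ] ⋖ u → g (suc ℓ) u * h (suc ℓ) u ≈ 1#
  g-upper ℓ ℓ<L v {⊥±} (lt , _) = contradiction lt below-⊥
  g-upper ℓ ℓ<L v {⊤±} _ = trans (*-congˡ (reflexive (h-fixed ⊤± (λ _ ()) (suc ℓ)))) (proj₁ (proj₂ ⊤-Inv))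
  g-upper ℓ ℓ<L v {[ i , j ]} v⋖u = proj₁ (g-inverse (suc ℓ) i j (inj₂ (positive (cover-inv v⋖u) , ℓ<L)))
    where
    positive : _ → 0 < toℕ i ℕ.+ toℕ j
    positive (inj₁ (e , _)) = ≡.subst (λ z → 0 < z ℕ.+ toℕ j) e (s≤s z≤n)
    positive (inj₂ (_ , e)) = ≡.subst (λ z → 0 < toℕ i ℕ.+ z) e (≡.subst (0 <_) (≡.sym (ℕₚ.+-suc (toℕ i) _)) (s≤s z≤n))

  F G : ℕ → Grid
  F ℓ = padBelow (h ℓ)
  G ℓ = padAbove (g ℓ)

  G-toℕ : ∀ ℓ i j → G ℓ (suc (toℕ i)) (suc (toℕ j)) ≈ g ℓ [ i , j ]
  G-toℕ ℓ i j = trans (padAbove-entry (g ℓ) (toℕ i) (toℕ j) (λ (_ , e) → ℕₚ.<⇒≢ (Finₚ.toℕ<n j) e))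
                      (reflexive (entry-toℕ (g ℓ) i j))

  F-toℕ : ∀ ℓ i j → F ℓ (suc (toℕ i)) (suc (toℕ j)) ≈ h ℓ [ i , j ]
  F-toℕ ℓ i j = reflexive (entry-toℕ (h ℓ) i j)

  transition-toℕ : ∀ ℓ i j → ℓ < suc L →
    F (suc ℓ) (suc (toℕ i)) (suc (toℕ j)) * upper (G (suc ℓ)) (suc (toℕ i)) (suc (toℕ j))
      ≈ lower (F ℓ) (suc (toℕ i)) (suc (toℕ j)) * G ℓ (suc (toℕ i)) (suc (toℕ j))
  transition-toℕ ℓ i j ℓ<L = begin
    F (suc ℓ) (suc (toℕ i)) (suc (toℕ j)) * upper (G (suc ℓ)) (suc (toℕ i)) (suc (toℕ j))
      ≈⟨ *-cong (F-toℕ (suc ℓ) i j) (sym (sum-above (g (suc ℓ)) i j)) ⟩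
    h (suc ℓ) [ i , j ] * sum K (map (g (suc ℓ)) (above [ i , j ]))
      ≈⟨ Toggled-transition {ls = map (h ℓ) (below [ i , j ])} {map (h (suc ℓ)) (above [ i , j ])} (step ℓ ℓ<L (i , j))
           (λ e → value-sumOfInverses (g (suc ℓ)) (h (suc ℓ)) (above [ i , j ]) e
             (λ u∈ → g-upper ℓ ℓ<L (i , j) (∈-above⁻ u∈)))
           (proj₁ (g-inverse ℓ i j (inj₁ ℓ<L))) ⟩
    sum K (map (h ℓ) (below [ i , j ])) * g ℓ [ i , j ]
      ≈⟨ *-cong (sum-below (h ℓ) i j) (sym (G-toℕ ℓ i j)) ⟩
    lower (F ℓ) (suc (toℕ i)) (suc (toℕ j)) * G ℓ (suc (toℕ i)) (suc (toℕ j)) ∎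

  on-Fin : ∀ {ℓ} (Q : ℕ → ℕ → Set ℓ) → (∀ (i : Fin (suc p)) (j : Fin (suc q)) → Q (toℕ i) (toℕ j)) →
           ∀ x y → x < suc p → y < suc q → Q x y
  on-Fin Q all x y x<p y<q = ≡.subst₂ Q (Finₚ.toℕ-fromℕ< x<p) (Finₚ.toℕ-fromℕ< y<q) (all (fromℕ< x<p) (fromℕ< y<q))

  open Dynamics K p q (suc L) (f ⊥±) (f ⊤±) (proj₁ ⊤-Inv) (proj₁ (proj₂ ⊤-Inv)) (proj₂ (proj₂ ⊤-Inv)) F G
    (λ _ _ → refl) (λ ℓ → reflexive (h-fixed ⊥± (λ _ ()) ℓ)) (λ _ _ → refl)
    (λ ℓ y _ → padAbove-right (g ℓ) (suc y)) (λ ℓ → padAbove-corner (g ℓ)) (λ ℓ → padAbove-top (g ℓ))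
    (λ ℓ → on-Fin (λ x y → Known ℓ x y → F ℓ (suc x) (suc y) * G ℓ (suc x) (suc y) ≈ 1#)
      (λ i j k → trans (*-cong (F-toℕ ℓ i j) (G-toℕ ℓ i j)) (proj₂ (g-inverse ℓ i j k))))
    (λ ℓ → on-Fin (λ x y → Known ℓ x y → G ℓ (suc x) (suc y) * F ℓ (suc x) (suc y) ≈ 1#)
      (λ i j k → trans (*-cong (G-toℕ ℓ i j) (F-toℕ ℓ i j)) (proj₁ (g-inverse ℓ i j k))))
    (λ ℓ x y ℓ<L x<p y<q → on-Fin (λ x y → F (suc ℓ) (suc x) (suc y) * upper (G (suc ℓ)) (suc x) (suc y)
                             ≈ lower (F ℓ) (suc x) (suc y) * G ℓ (suc x) (suc y))
      (λ i j → transition-toℕ ℓ i j ℓ<L) x y x<p y<q)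
    public using (reciprocal)

  reciprocity : ∀ (i : Fin (suc p)) (j : Fin (suc q)) k → k ℕ.+ toℕ i ℕ.+ suc (toℕ j) ≡ suc L →
    Σ[ Rᵏf≠⊥ ∈ Defined ((rowmotion K P vs ^ₚ k) f) ]
    Σ[ x-invertible ∈ Inv (value ((rowmotion K P vs ^ₚ k) f) Rᵏf≠⊥ [ opposite i , opposite j ]) ]
      value ((rowmotion K P vs ^ₚ suc L) f) d [ i , j ] ≈ f ⊥± * proj₁ x-invertible * f ⊤±
  reciprocity i j k e =
    proj₁ dₖ , (g k [ opposite i , opposite j ] , g-inverseₖ (proj₂ dₖ)) , (begin
      value ((rowmotion K P vs ^ₚ suc L) f) d [ i , j ]
        ≈⟨ reflexive (≡.cong (λ y → y [ i , j ]) (orbit-last (suc L) d)) ⟨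
      h (suc L) [ i , j ]
        ≈⟨ F-toℕ (suc L) i j ⟨
      F (suc L) (suc (toℕ i)) (suc (toℕ j))
        ≈⟨ reciprocal (suc (toℕ j)) (suc L) (toℕ i) (toℕ (opposite i)) (toℕ (opposite j)) k
             (opposite-+ i) (≡.cong suc (opposite-+ j)) e ℕₚ.≤-refl ⟩
      f ⊥± * G k (suc (toℕ (opposite i))) (suc (toℕ (opposite j))) * f ⊤±
        ≈⟨ *-congʳ (*-congˡ (G-toℕ k (opposite i) (opposite j))) ⟩
      f ⊥± * g k [ opposite i , opposite j ] * f ⊤± ∎)
    where
    k<L : k < suc L
    k<L = ≡.subst (k <_) (≡.trans (≡.sym (ℕₚ.+-suc (k ℕ.+ toℕ i) (toℕ j))) e)
            (s≤s (ℕₚ.≤-trans (ℕₚ.m≤m+n k (toℕ i)) (ℕₚ.m≤m+n (k ℕ.+ toℕ i) (toℕ j))))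
    dₖ = orbit-defined (suc L) d k (ℕₚ.<⇒≤ k<L)
    g-inverseₖ : ∀ {y} → y ≡ h k → g k [ opposite i , opposite j ] * y [ opposite i , opposite j ] ≈ 1#
                                 × y [ opposite i , opposite j ] * g k [ opposite i , opposite j ] ≈ 1#
    g-inverseₖ ≡.refl = g-inverse k (opposite i) (opposite j) (inj₁ k<L)
    opposite-+ : ∀ {n} (i : Fin (suc n)) → toℕ i ℕ.+ toℕ (opposite i) ≡ n
    opposite-+ i = ≡.trans (≡.cong (toℕ i ℕ.+_) (Finₚ.opposite-prop i)) (ℕₚ.m+[n∸m]≡n (ℕ.s≤s⁻¹ (Finₚ.toℕ<n i)))

open import Data.Nat using (_+_; _∸_)

theorem4p8 :
    ∀ {c r} (K : Ring c r) (p q : ℕ) .{{_ : NonZero p}} .{{_ : NonZero q}}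
    (vs : List (Fin p × Fin q)) → IsLinearExtension (rectangle p q) vs →
    let open Ring K using (_≈_)
        open Ring K using (_*_)
        R = rowmotion K (rectangle p q) vs
    in
    (ℓ : ℕ) (f : Labeling K (rectangle p q)) (Rˡf≠⊥ : Defined ((R ^ₚ ℓ) f)) →
    let a = f ⊥±
        b = f ⊤±
    in
    (i : Fin p) (j : Fin q) → index i + index j ≤ ℓ + 1 →
    let k = ℓ + 1 ∸ (index i + index j)
    in
    Σ[ Rᵏf≠⊥ ∈ Defined ((R ^ₚ k) f) ]
    let x = value ((R ^ₚ k) f) Rᵏf≠⊥ [ opposite i , opposite j ]
    in
    Σ[ x-invertible ∈ Defined (inverse K x) ]
      value ((R ^ₚ ℓ) f) Rˡf≠⊥ [ i , j ] ≈ a * value (inverse K x) x-invertible * b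
-- Both indices are at least 1, so their sum exceeds `0 + 1` and the inequality is absurd.
theorem4p8 K (suc p) (suc q) vs ext zero f d i j (s≤s le) =
  contradiction (≡.subst (_≤ 0) (ℕₚ.+-suc (toℕ i) (toℕ j)) le) λ ()
theorem4p8 K (suc p) (suc q) vs ext (suc L) f d i j le =
  RectangleReciprocity.reciprocity K p q vs ext f L d i j (suc L + 1 ∸ (index i + index j)) (ℕₚ.suc-injective time)
  where
  k = suc L + 1 ∸ (index i + index j)
  -- The leading `suc` turns `toℕ i` into `index i`, after which `k` cancels the subtraction.
  time : suc (k + toℕ i + suc (toℕ j)) ≡ suc (suc L)
  time = ≡.trans (≡.cong suc (ℕₚ.+-assoc k (toℕ i) _))
    (≡.trans (≡.sym (ℕₚ.+-suc k _)) (≡.trans (ℕₚ.m∸n+n≡m le) (ℕₚ.+-comm (suc L) 1)))
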